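{- Let $G,H,K$ be finite abelian groups with conjugate groups $G',H',K'$. If $M(G')=M(H')M(K')$ is a SNF factorisation, then $G= H\oplus K$ is a direct factorisation; and conversely, if $G= H\oplus K$ is a direct factorisation, then $M(G')=M(H')M(K')$ is a SNF factorisation.
   Context: Groups are considered up to isomorphism, so that "$G=H\oplus K$ is a direct factorisation" means $G\cong H\oplus K$ (equivalently $G$ is the sum of two subgroups, isomorphic to $H$ and $K$, with trivial intersection). Smith normal form (SNF): a diagonal integer matrix $\mathrm{diag}[n_1,n_1n_2,\dots,n_1n_2\cdots n_r]$ with positive integers $n_i$ (each diagonal entry divides the next). To a finite abelian group $G\cong \mathbb Z/n_1\mathbb Z\oplus\mathbb Z/n_1n_2\mathbb Z\oplus\cdots\oplus\mathbb Z/n_1\cdots n_r\mathbb Z$ one associates $M(G)=\mathrm{diag}[n_1,n_1n_2,\dots,n_1\cdots n_r]$. Leading entries equal to $1$ are allowed, so $M(G)$ can be written as an $r\times r$ matrix for any $r$ at least the rank (minimal number of generators) of $G$; in a product $M(G')=M(H')M(K')$ all matrices are taken of the same common size. A SNF factorisation of a SNF matrix $S$ is a decomposition of $S$ as a product of SNF matrices. Conjugate group: for a prime $p$ and a finite abelian $p$-group $G\cong \mathbb Z/p^{a_1}\mathbb Z\oplus\cdots\oplus\mathbb Z/p^{a_r}\mathbb Z$ with $0\le a_1\le\cdots\le a_r$, the type of $G$ is the partition $\lambda=(a_1,\dots,a_r)$, and the conjugate $G'$ of $G$ is the finite abelian $p$-group whose type is the conjugate (transposed) partition $\lambda'$. For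 a general finite abelian group, $G'$ is the direct sum of the conjugates of its $p$-primary components. -}

module Defs where

open import Algebra.Bundles using (AbelianGroup)
import Algebra.Construct.DirectProduct as DirectProduct
import Algebra.Construct.Terminal as Terminal
open import Algebra.Morphism.Structures using (module GroupMorphisms)
import Algebra.Morphism.GroupMonomorphism as GroupMonomorphism
import Algebra.Properties.AbelianGroup as AbelianGroupProperties
import Algebra.Properties.CommutativeMonoid.Mult as Mult
open import Algebra.Properties.Monoid.Sum using (sum)
open import Data.Bool.Base using (if_then_else_)
open import Data.Fin.Base using (Fin)
open import Data.Fin.Properties using (_≟_)
open import Data.Integer.Base as ℤ using (ℤ; +_)
open import Data.Integer.Divisibility.Signed
  using (_∣_; divides; ∣m∣n⇒∣m+n; ∣m⇒∣-m)
import Data.Integer.Properties as ℤ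
open import Data.Integer.Tactic.RingSolver using (solve-∀)
open import Data.List.Base using (List; length; map; filter; foldr; upTo; downFrom)
open import Data.List.Membership.Propositional using (_∈_)
open import Data.List.Relation.Unary.Linked using (Linked)
open import Data.Nat.Base as ℕ using (ℕ; zero; suc; _≤_; _⊔_; _^_; NonZero)
import Data.Nat.Divisibility as ℕ
import Data.Nat.Properties as ℕ
open import Data.Nat.Primality using (prime?)
open import Data.Product.Base using (Σ; Σ-syntax; ∃-syntax; _×_; _,_; proj₁; proj₂)
open import Data.Vec.Base as Vec using (Vec; []; _∷_; lookup)
open import Data.Vec.Functional using (Vector)
open import Data.Vec.Relation.Unary.All using (All)
open import Function.Bundles using (Inverse)
open import Level using (Level; 0ℓ) renaming (suc to lsuc; _⊔_ to _⊔ˡ_)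
open import Relation.Binary.PropositionalEquality using (_≡_; refl; cong; subst; setoid)
open import Relation.Nullary.Decidable using (does; _×-dec_)

private
  variable
    a b ℓ₁ ℓ₂ : Level
    r : ℕ

------------------------------------------------------------------------
-- Abelian groups

infix 4 _≅_
infixr 6 _⊕_

_≅_ : AbelianGroup a ℓ₁ → AbelianGroup b ℓ₂ → Set (a ⊔ˡ b ⊔ˡ ℓ₁ ⊔ˡ ℓ₂)
G ≅ H = Σ[ f ∈ (Carrier G → Carrier H) ] IsGroupIsomorphism f
  where
  open AbelianGroup using (Carrier; rawGroup)
  open GroupMorphisms (rawGroup G) (rawGroup H) using (IsGroupIsomorphism)

_⊕_ : AbelianGroup a ℓ₁ → AbelianGroup b ℓ₂ →
      AbelianGroup (a ⊔ˡ b) (ℓ₁ ⊔ˡ ℓ₂)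
_⊕_ = DirectProduct.abelianGroup

⨁ : List (AbelianGroup 0ℓ 0ℓ) → AbelianGroup 0ℓ 0ℓ
⨁ = foldr _⊕_ Terminal.abelianGroup

record FiniteAbelianGroup (c ℓ : Level) : Set (lsuc (c ⊔ˡ ℓ)) where
  field
    abelianGroup : AbelianGroup c ℓ
    order        : ℕ
    enumeration  : Inverse (AbelianGroup.setoid abelianGroup) (setoid (Fin order))

  open AbelianGroup abelianGroup public

-- The integers with congruence modulo n as their equality.
ℤ/_ : ℕ → AbelianGroup 0ℓ 0ℓ
ℤ/ n = record
  { Carrier = ℤ
  ; _≈_     = _≈_
  ; _∙_     = ℤ._+_
  ; ε       = ℤ.0ℤ
  ; _⁻¹     = ℤ.-_
  ; isAbelianGroup = record
    { isGroup = record
      { isMonoid = record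
        { isSemigroup = record
          { isMagma = record
            { isEquivalence = record
              { refl  = λ {x} → ≡⇒≈ {x} refl
              ; sym   = λ {x} {y} p →
                  subst (+ n ∣_) (swap x y) (∣m⇒∣-m p)
              ; trans = λ {x} {y} {z} p q →
                  subst (+ n ∣_) (chain x y z) (∣m∣n⇒∣m+n p q)
              }
            ; ∙-cong = λ {x} {y} {u} {v} p q →
                subst (+ n ∣_) (interchange x y u v) (∣m∣n⇒∣m+n p q)
            }
          ; assoc = λ x y z → ≡⇒≈ (ℤ.+-assoc x y z)
          }
        ; identity = (λ x → ≡⇒≈ (ℤ.+-identityˡ x)) , (λ x → ≡⇒≈ (ℤ.+-identityʳ x))
        }
      ; inverse = (λ x → ≡⇒≈ (ℤ.+-inverseˡ x)) , (λ x → ≡⇒≈ (ℤ.+-inverseʳ x))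
      ; ⁻¹-cong = λ {x} {y} p → subst (+ n ∣_) (negate x y) (∣m⇒∣-m p)
      }
    ; comm = λ x y → ≡⇒≈ (ℤ.+-comm x y)
    }
  }
  where
  _≈_ : ℤ → ℤ → Set
  x ≈ y = + n ∣ x ℤ.- y

  ≡⇒≈ : ∀ {x y} → x ≡ y → x ≈ y
  ≡⇒≈ {x} refl = divides ℤ.0ℤ (ℤ.+-inverseʳ x)

  swap : ∀ x y → ℤ.- (x ℤ.- y) ≡ y ℤ.- x
  swap = solve-∀

  chain : ∀ x y z → (x ℤ.- y) ℤ.+ (y ℤ.- z) ≡ x ℤ.- z
  chain = solve-∀

  interchange : ∀ x y u v →
    (x ℤ.- y) ℤ.+ (u ℤ.- v) ≡ (x ℤ.+ u) ℤ.- (y ℤ.+ v)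
  interchange = solve-∀

  negate : ∀ x y → ℤ.- (x ℤ.- y) ≡ ℤ.- x ℤ.- ℤ.- y
  negate = solve-∀

-- The subgroup of elements annihilated by some power of p.
primaryComponent : ℕ → AbelianGroup a ℓ₁ → AbelianGroup (a ⊔ˡ ℓ₁) ℓ₁
primaryComponent p G = record
  { Carrier = Σ[ x ∈ Carrier ] ∃[ k ] (p ^ k) · x ≈ ε
  ; _≈_     = λ x y → proj₁ x ≈ proj₁ y
  ; _∙_     = λ { (x , k , px) (y , l , py) → x ∙ y , k ℕ.+ l , ∙-closed x y k l px py }
  ; ε       = ε , 0 , identityʳ ε
  ; _⁻¹     = λ { (x , k , px) → x ⁻¹ , k , ⁻¹-closed x (p ^ k) px }
  ; isAbelianGroup = GroupMonomorphism.isAbelianGroup proj₁-isMonomorphism isAbelianGroup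
  }
  where
  open AbelianGroup G renaming (refl to ≈-refl)
  open Mult commutativeMonoid renaming (_×_ to infixr 8 _·_)
  open AbelianGroupProperties G using (inverseˡ-unique; ε⁻¹≈ε)
  open import Relation.Binary.Reasoning.Setoid (AbelianGroup.setoid G)

  ·-ε : ∀ n → n · ε ≈ ε
  ·-ε zero    = ≈-refl
  ·-ε (suc n) = trans (identityˡ _) (·-ε n)

  annihilates : ∀ x m n → n · x ≈ ε → (m ℕ.* n) · x ≈ ε
  annihilates x m n nx≈ε = begin
    (m ℕ.* n) · x  ≈⟨ ×-assocˡ x m n ⟨
    m · (n · x)    ≈⟨ ×-congʳ m nx≈ε ⟩
    m · ε          ≈⟨ ·-ε m ⟩
    ε              ∎

  ∙-closed : ∀ x y k l → (p ^ k) · x ≈ ε → (p ^ l) · y ≈ ε →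
             (p ^ (k ℕ.+ l)) · (x ∙ y) ≈ ε
  ∙-closed x y k l px py = begin
    (p ^ (k ℕ.+ l)) · (x ∙ y)
      ≡⟨ cong (_· (x ∙ y)) (ℕ.^-distribˡ-+-* p k l) ⟩
    (p ^ k ℕ.* p ^ l) · (x ∙ y)
      ≈⟨ ×-distrib-+ x y (p ^ k ℕ.* p ^ l) ⟩
    (p ^ k ℕ.* p ^ l) · x ∙ (p ^ k ℕ.* p ^ l) · y
      ≡⟨ cong (λ n → n · x ∙ (p ^ k ℕ.* p ^ l) · y) (ℕ.*-comm (p ^ k) (p ^ l)) ⟩
    (p ^ l ℕ.* p ^ k) · x ∙ (p ^ k ℕ.* p ^ l) · y
      ≈⟨ ∙-cong (annihilates x (p ^ l) (p ^ k) px) (annihilates y (p ^ k) (p ^ l) py) ⟩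
    ε ∙ ε
      ≈⟨ identityʳ ε ⟩
    ε ∎

  ⁻¹-closed : ∀ x n → n · x ≈ ε → n · (x ⁻¹) ≈ ε
  ⁻¹-closed x n nx≈ε = begin
    n · (x ⁻¹)             ≈⟨ identityʳ _ ⟨
    n · (x ⁻¹) ∙ ε         ≈⟨ ∙-congˡ nx≈ε ⟨
    n · (x ⁻¹) ∙ n · x     ≈⟨ ×-distrib-+ (x ⁻¹) x n ⟨
    n · (x ⁻¹ ∙ x)         ≈⟨ ×-congʳ n (inverseˡ x) ⟩
    n · ε                  ≈⟨ ·-ε n ⟩
    ε                      ∎

  open GroupMorphisms using (IsGroupMonomorphism)

  proj₁-isMonomorphism : IsGroupMonomorphism _ rawGroup proj₁
  proj₁-isMonomorphism = record
    { isGroupHomomorphism = record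
      { isMonoidHomomorphism = record
        { isMagmaHomomorphism = record
          { isRelHomomorphism = record { cong = λ x≈y → x≈y }
          ; homo = λ _ _ → ≈-refl
          }
        ; ε-homo = ≈-refl
        }
      ; ⁻¹-homo = λ _ → ≈-refl
      }
    ; injective = λ x≈y → x≈y
    }

------------------------------------------------------------------------
-- Types of p-groups, and conjugate groups

-- A partition is a weakly increasing list; parts equal to 0 are allowed.
IsPartition : List ℕ → Set
IsPartition = Linked _≤_

-- The j-th part of the conjugate is the number of parts of λs that are ≥ j.
-- It is listed for j = max, …, 1, hence again in weakly increasing order.
conjugate : List ℕ → List ℕ
conjugate λs =
  map (λ j → length (filter (ℕ._≤?_ (suc j)) λs)) (downFrom (foldr _⊔_ 0 λs))

pGroup : ℕ → List ℕ → AbelianGroup 0ℓ 0ℓ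
pGroup p λs = ⨁ (map (λ i → ℤ/ (p ^ i)) λs)

HasType : ℕ → AbelianGroup a ℓ₁ → List ℕ → Set (a ⊔ˡ ℓ₁)
HasType p G λs = IsPartition λs × G ≅ pGroup p λs

primeDivisors : ℕ → List ℕ
primeDivisors n = filter (λ p → prime? p ×-dec p ℕ.∣? n) (upTo (suc n))

-- G′ is a conjugate of G; `type p` is the type of the p-primary component of
-- G when p divides the order of G, and is irrelevant otherwise.
IsConjugate : FiniteAbelianGroup a ℓ₁ → AbelianGroup b ℓ₂ →
              Set (a ⊔ˡ ℓ₁ ⊔ˡ b ⊔ˡ ℓ₂)
IsConjugate G G′ = Σ[ type ∈ (ℕ → List ℕ) ]
  (∀ {p} → p ∈ primes → HasType p (primaryComponent p abelianGroup) (type p)) ×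
  G′ ≅ ⨁ (map (λ p → pGroup p (conjugate (type p))) primes)
  where
  open FiniteAbelianGroup G using (abelianGroup; order)
  primes = primeDivisors order

------------------------------------------------------------------------
-- Integer matrices and Smith normal forms

infix  4 _≋_
infixl 7 _*ᴹ_

Matrix : ℕ → Set
Matrix r = Vector (Vector ℤ r) r

_≋_ : Matrix r → Matrix r → Set
A ≋ B = ∀ i j → A i j ≡ B i j

_*ᴹ_ : Matrix r → Matrix r → Matrix r
(A *ᴹ B) i j = sum ℤ.+-0-monoid (λ k → A i k ℤ.* B k j)

diag : Vec ℕ r → Matrix r
diag ds i j = if does (i ≟ j) then + lookup ds i else ℤ.0ℤ

-- n₁, n₁n₂, …, n₁n₂⋯nᵣ
partialProducts : Vec ℕ r → Vec ℕ r
partialProducts []       = []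
partialProducts (n ∷ ns) = n ∷ Vec.map (n ℕ.*_) (partialProducts ns)

IsSNF : Matrix r → Set
IsSNF {r} S = Σ[ ns ∈ Vec ℕ r ] All NonZero ns × S ≋ diag (partialProducts ns)

-- S is the matrix M(G), written in size r.
IsM : AbelianGroup a ℓ₁ → Matrix r → Set (a ⊔ˡ ℓ₁)
IsM {r = r} G S = Σ[ ns ∈ Vec ℕ r ] All NonZero ns ×
  G ≅ ⨁ (map ℤ/_ (Vec.toList (partialProducts ns))) ×
  S ≋ diag (partialProducts ns)

-- S = TU is a SNF factorisation.
IsSNFFactorisation : (S T U : Matrix r) → Set
IsSNFFactorisation S T U = IsSNF S × IsSNF T × IsSNF U × S ≋ T *ᴹ U

{-# OPTIONS --safe #-}

-- Write λ(p) for the type of the p-primary component of G and cⱼ(p) for the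
-- number of parts of λ(p) that exceed j.  The conjugate partition has the
-- parts cⱼ(p), and the diagonal of M(G′) is increasing for divisibility, so the
-- p-adic valuations of its entries, read from the last one, are c₀(p), c₁(p), ….
-- Hence M(G′) = M(H′) M(K′) says exactly that cⱼ(p) is additive, for all j and p.
-- On the other hand G has p ^ Σ_{j<k} cⱼ(p) elements killed by p ^ k, so
-- G ≅ H ⊕ K forces the same additivity.  Conversely, additivity says that λ(p) is
-- the union of the types of H and K up to order and zero parts, and G is the
-- direct sum of its primary components.
module Submission where

open import Defs
open import Algebra.Bundles using (AbelianGroup)
open import Algebra.Morphism.Structures using (module GroupMorphisms)
import Algebra.Properties.AbelianGroup as AbelianGroupProperties
import Algebra.Properties.CommutativeMonoid.Mult as Mult
import Algebra.Properties.CommutativeMonoid.Sum as Sum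
import Algebra.Properties.CommutativeSemigroup as CommutativeSemigroupProperties
import Algebra.Properties.Group as GroupProperties
open import Data.Bool.Base using (if_then_else_)
open import Data.Fin.Base as Fin using (Fin; zero; suc; toℕ; fromℕ<; opposite; combine; remQuot)
open import Data.Fin.Permutation using (Permutation; permutation)
import Data.Fin.Properties as Fin
open import Data.Integer.Base as ℤ using (ℤ; +_)
open import Data.Integer.DivMod using (_/ℕ_; _%ℕ_; n%ℕd<d; a≡a%ℕn+[a/ℕn]*n)
open import Data.Integer.Divisibility.Signed using (divides; ∣ᵤ⇒∣; ∣⇒∣ᵤ) renaming (_∣_ to _∣ℤ_)
import Data.Integer.Properties as ℤ
open import Data.Integer.Tactic.RingSolver using (solve-∀)
open import Data.List.Base using (List; []; _∷_; _++_; length; map; filter; foldr; downFrom; upTo)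
open import Data.List.Membership.Propositional using (_∈_; _∉_)
open import Data.List.Membership.Propositional.Properties
  using (∈-filter⁺; ∈-filter⁻; ∈-upTo⁺; ∈-map⁺; ∈-∃++)
open import Data.List.Properties
  using
    ( filter-accept; filter-reject; filter-++; length-++; map-++; length-filter; length-map
    ; length-downFrom)
open import Data.List.Relation.Binary.Permutation.Propositional as ↭ using (_↭_)
open import Data.List.Relation.Binary.Permutation.Propositional.Properties using (shift; filter-↭; ↭-length)
open import Data.List.Relation.Unary.All as All using (All; []; _∷_)
open import Data.List.Relation.Unary.AllPairs using (AllPairs; []; _∷_)
open import Data.List.Relation.Unary.Any using (here; there)
open import Data.List.Relation.Unary.Unique.Propositional using (Unique)
import Data.List.Relation.Unary.Unique.Propositional.Properties as Unique
open import Data.Nat.Base as ℕ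
  using (ℕ; zero; suc; _+_; _*_; _^_; _⊓_; _⊔_; _≤_; _<_; z≤n; s≤s; NonZero; NonTrivial)
open import Data.Nat.Coprimality as Coprimality using (Coprime)
open import Data.Nat.Divisibility as ℕ∣ using (divides) renaming (_∣_ to _∣ℕ_; _∤_ to _∤ℕ_)
open import Data.Nat.GCD
  using
    ( gcd; gcd[m,n]∣m; gcd[m,n]∣n; gcd-greatest; c*gcd[m,n]≡gcd[cm,cn]; GCD; gcd-GCD; GCD-*
    ; module Bézout)
open import Data.Nat.ListAction using (sum; product)
open import Data.Nat.ListAction.Properties using (sum-++)
open import Data.Nat.Primality
  using
    (Prime; prime?; euclidsLemma; prime⇒nonTrivial; prime⇒nonZero; prime⇒irreducible; ¬prime[1])
open import Data.Nat.Primality.Factorisation using (factorise)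
import Data.Nat.Properties as ℕ
import Data.Nat.Tactic.RingSolver as ℕ-Solver
open import Data.List.Membership.DecPropositional ℕ._≟_ using (_∈?_)
open import Data.Product.Base using (∃; ∃₂; _×_; _,_; proj₁; proj₂)
open import Data.Sum.Base using (inj₁; inj₂; [_,_]′)
open import Data.Vec.Base as Vec using (Vec; []; _∷_; lookup; toList)
open import Data.Vec.Functional using (Vector)
open import Data.Vec.Membership.Propositional.Properties using (∈-lookup)
open import Data.Vec.Properties using (lookup-map; length-toList)
import Data.Vec.Relation.Unary.All as VecAll
open import Function.Base using (_∘_; id)
open import Function.Bundles using (_⇔_; mk⇔; Equivalence; Inverse)
open import Function.Construct.Composition using (_⇔-∘_)
open import Level using (Level; 0ℓ) renaming (_⊔_ to _⊔ˡ_)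
open import Relation.Binary.Definitions using (tri<; tri≈; tri>)
open import Relation.Binary.PropositionalEquality as ≡ using (_≡_; _≢_)
import Relation.Binary.Reasoning.Setoid as SetoidReasoning
open import Relation.Nullary using (Dec; yes; no; contradiction)
open import Relation.Nullary.Decidable using (does; _×-dec_)
open import Relation.Unary using (Decidable)

open CommutativeSemigroupProperties ℕ.+-commutativeSemigroup using (x∙yz≈y∙xz)
open CommutativeSemigroupProperties ℕ.*-commutativeSemigroup using () renaming (interchange to *-interchange)

-- Partitions

-- How the diagonal of M(G′) reflects the type of G has to be proved, since `IsConjugate` and `IsM`
-- present G′ as two different sums of cyclic groups. Counting the elements killed by p ^ k settles
-- this too: the count is invariant under isomorphism, multiplicative over direct sums, and
-- computable in both presentations. It thus carries the uniqueness of invariant factors. Three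
-- mismatches shape the rest. The orders of G, H and K may have different prime divisors, and a
-- given type means nothing at other primes; it is set to [] there, and the three groups are split
-- over the primes of one common multiple of the orders. Types that agree up to order and zero parts
-- are different lists, so they are compared through their counts only. Finally, a matrix of size r
-- shows cⱼ only for j < r; the later counts vanish because G′ is a sum of r cyclic groups.

count : ℕ → List ℕ → ℕ
count k xs = length (filter (suc k ℕ.≤?_) xs)

count-∷-< : ∀ {k x} xs → k < x → count k (x ∷ xs) ≡ suc (count k xs)
count-∷-< {k} xs k<x = ≡.cong length (filter-accept (suc k ℕ.≤?_) k<x)

count-∷-≤ : ∀ {k x} xs → x ≤ k → count k (x ∷ xs) ≡ count k xs
count-∷-≤ {k} xs x≤k = ≡.cong length (filter-reject (suc k ℕ.≤?_) (ℕ.≤⇒≯ x≤k))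

count-++ : ∀ k xs ys → count k (xs ++ ys) ≡ count k xs + count k ys
count-++ k xs ys = ≡.trans (≡.cong length (filter-++ (suc k ℕ.≤?_) xs ys))
                         (length-++ (filter (suc k ℕ.≤?_) xs))

count≤length : ∀ k xs → count k xs ≤ length xs
count≤length k = length-filter (suc k ℕ.≤?_)

count-antitone : ∀ {j k} → j ≤ k → ∀ xs → count k xs ≤ count j xs
count-antitone j≤k [] = z≤n
count-antitone {j} {k} j≤k (x ∷ xs) with x ℕ.≤? k | x ℕ.≤? j
... | yes x≤k | yes x≤j
  rewrite count-∷-≤ xs x≤k | count-∷-≤ xs x≤j = count-antitone j≤k xs
... | yes x≤k | no  x≰j
  rewrite count-∷-≤ xs x≤k | count-∷-< xs (ℕ.≰⇒> x≰j) = ℕ.m≤n⇒m≤1+n (count-antitone j≤k xs)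
... | no  x≰k | yes x≤j = contradiction (ℕ.≤-trans x≤j j≤k) x≰k
... | no  x≰k | no  x≰j
  rewrite count-∷-< xs (ℕ.≰⇒> x≰k) | count-∷-< xs (ℕ.≰⇒> x≰j) = s≤s (count-antitone j≤k xs)

count>0⇒<max : ∀ {k} xs → 0 < count k xs → k < foldr _⊔_ 0 xs
count>0⇒<max {k} (x ∷ xs) 0<c with x ℕ.≤? k
... | yes x≤k rewrite count-∷-≤ xs x≤k =
  ℕ.<-≤-trans (count>0⇒<max xs 0<c) (ℕ.m≤n⊔m x _)
... | no  x≰k = ℕ.<-≤-trans (ℕ.≰⇒> x≰k) (ℕ.m≤m⊔n x _)

-- pGroup p xs has p ^ weight k xs elements killed by p ^ k.
weight : ℕ → List ℕ → ℕ
weight k xs = sum (map (_⊓ k) xs)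

weight-++ : ∀ k xs ys → weight k (xs ++ ys) ≡ weight k xs + weight k ys
weight-++ k xs ys = ≡.trans (≡.cong sum (map-++ (_⊓ k) xs ys)) (sum-++ (map (_⊓ k) xs) _)

-- Raising the cap from k to k + 1 adds one for each part above k, so `count` is the discrete
-- derivative of `weight`. This is how the counts are recovered from numbers of torsion elements.
weight-suc : ∀ k xs → weight (suc k) xs ≡ count k xs + weight k xs
weight-suc k [] = ≡.refl
weight-suc k (x ∷ xs) with x ℕ.≤? k
... | yes x≤k rewrite count-∷-≤ xs x≤k | ℕ.m≤n⇒m⊓n≡m x≤k | ℕ.m≤n⇒m⊓n≡m (ℕ.m≤n⇒m≤1+n x≤k)
                    | weight-suc k xs = x∙yz≈y∙xz x (count k xs) (weight k xs)
... | no  x≰k rewrite count-∷-< xs (ℕ.≰⇒> x≰k) | ℕ.m≥n⇒m⊓n≡n (ℕ.<⇒≤ (ℕ.≰⇒> x≰k)) | ℕ.m≥n⇒m⊓n≡n (ℕ.≰⇒> x≰k)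
                    | weight-suc k xs = ≡.cong suc (x∙yz≈y∙xz k (count k xs) (weight k xs))

weight≗⇒count≗ : ∀ xs ys → (∀ k → weight k xs ≡ weight k ys) → ∀ k → count k xs ≡ count k ys
weight≗⇒count≗ xs ys eq k = ℕ.+-cancelʳ-≡ (weight k xs) _ _ (begin
  count k xs + weight k xs  ≡⟨ weight-suc k xs ⟨
  weight (suc k) xs         ≡⟨ eq (suc k) ⟩
  weight (suc k) ys         ≡⟨ weight-suc k ys ⟩
  count k ys + weight k ys  ≡⟨ ≡.cong (λ w → count k ys + w) (eq k) ⟨
  count k ys + weight k xs  ∎)
  where open ≡.≡-Reasoning

-- Since h is antitone, the arguments below m at which h exceeds k form an initial segment of ℕ, and
-- the count is the length of that segment.
count-map-downFrom : ∀ (h : ℕ → ℕ) → (∀ {i j} → i ≤ j → h j ≤ h i) →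
  ∀ m j k → j < count k (map h (downFrom m)) ⇔ (j < m × k < h j)
count-map-downFrom h anti zero    j k = mk⇔ (λ ()) λ ()
count-map-downFrom h anti (suc m) j k with h m ℕ.≤? k
... | yes hm≤k rewrite count-∷-≤ (map h (downFrom m)) hm≤k = mk⇔
  (λ j<c → let j<m , k<hj = Equivalence.to IH j<c in ℕ.m<n⇒m<1+n j<m , k<hj)
  (λ { (s≤s j≤m , k<hj) → Equivalence.from IH (ℕ.≤∧≢⇒< j≤m (λ { ≡.refl → ℕ.<⇒≱ k<hj hm≤k }) , k<hj) })
  where IH = count-map-downFrom h anti m j k
-- Now h m > k, hence h i > k for all i < m as well: the segment is full and c equals m.
... | no  hm≰k rewrite count-∷-< (map h (downFrom m)) (ℕ.≰⇒> hm≰k) = mk⇔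
  (λ { (s≤s j≤c) → let j≤m = ℕ.≤-trans j≤c c≤m in s≤s j≤m , ℕ.<-≤-trans (ℕ.≰⇒> hm≰k) (anti j≤m) })
  (λ { (s≤s j≤m , _) → s≤s (ℕ.≤-trans j≤m (m≤c m (λ i<m → Equivalence.from (count-map-downFrom h anti m _ k)
         (i<m , ℕ.<-≤-trans (ℕ.≰⇒> hm≰k) (anti (ℕ.<⇒≤ i<m))) ))) })
  where
  c = count k (map h (downFrom m))

  c≤m : c ≤ m
  c≤m = ≡.subst (c ≤_) (≡.trans (length-map h (downFrom m)) (length-downFrom m))
    (count≤length k (map h (downFrom m)))

  m≤c : ∀ n → (∀ {i} → i < n → i < c) → n ≤ c
  m≤c zero    _ = z≤n
  m≤c (suc n) f = f ℕ.≤-refl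

-- Both sides say that the same box lies in the Young diagram, read once by columns and once by
-- rows. The cut-off at the largest part in `conjugate` is harmless, because a positive count
-- already forces j below it.
count-conjugate : ∀ xs j k → j < count k (conjugate xs) ⇔ k < count j xs
count-conjugate xs j k = mk⇔
  (λ j<c → proj₂ (Equivalence.to lemma j<c))
  (λ k<c → Equivalence.from lemma (count>0⇒<max xs (ℕ.≤-<-trans z≤n k<c) , k<c))
  where lemma = count-map-downFrom (λ j → count j xs) (λ i≤j → count-antitone i≤j xs) _ j k

-- In an increasing vector the entries above k fill the last places. An entry is one of them exactly
-- when its distance from the end, which is what `opposite` measures, is less than their number.
count-sorted : ∀ {r} (xs : Vec ℕ r) →
  (∀ i j → i Fin.≤ j → lookup xs i ≤ lookup xs j) →
  ∀ i k → k < lookup xs i ⇔ toℕ (opposite i) < count k (toList xs)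
count-sorted {suc n} (x ∷ xs) sorted i k with x ℕ.≤? k
... | no x≰k rewrite count-∷-< (toList xs) (ℕ.≰⇒> x≰k) = mk⇔
  (λ _ → ≡.subst (toℕ (opposite i) <_) (≡.cong suc (≡.sym (all n xs λ j →
           ℕ.<-≤-trans (ℕ.≰⇒> x≰k) (sorted zero (suc j) z≤n)))) (Fin.toℕ<n (opposite i)))
  (λ _ → ℕ.<-≤-trans (ℕ.≰⇒> x≰k) (sorted zero i z≤n))
  where
  all : ∀ n (ys : Vec ℕ n) → (∀ j → k < lookup ys j) → count k (toList ys) ≡ n
  all _ []       _ = ≡.refl
  all _ (y ∷ ys) f = ≡.trans (count-∷-< (toList ys) (f zero)) (≡.cong suc (all _ ys (f ∘ suc)))
count-sorted {suc n} (x ∷ xs) sorted zero k | yes x≤k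
  rewrite count-∷-≤ (toList xs) x≤k | Fin.toℕ-fromℕ n = mk⇔
  (λ k<x → contradiction x≤k (ℕ.<⇒≱ k<x))
  (λ n<c → contradiction
    (≡.subst (count k (toList xs) ≤_) (length-toList xs) (count≤length k (toList xs))) (ℕ.<⇒≱ n<c))
count-sorted {suc n} (x ∷ xs) sorted (suc i) k | yes x≤k
  rewrite count-∷-≤ (toList xs) x≤k | Fin.toℕ-inject₁ (opposite i) =
  count-sorted xs (λ i j i≤j → sorted (suc i) (suc j) (s≤s i≤j)) i k

<-ext : ∀ {m n} → (∀ k → k < m ⇔ k < n) → m ≡ n
<-ext {m} {n} f = ℕ.≤-antisym (ℕ.≮⇒≥ (λ n<m → ℕ.<-irrefl ≡.refl (Equivalence.to (f n) n<m)))
                              (ℕ.≮⇒≥ (λ m<n → ℕ.<-irrefl ≡.refl (Equivalence.from (f m) m<n)))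

-- Valuations

-- The fuel makes the recursion structural. For n > 0 and p ≥ 2 the number n is itself enough fuel,
-- since every division by p makes it smaller.
valuationFuel : ℕ → ℕ → ℕ → ℕ
valuationFuel zero    p n = 0
valuationFuel (suc f) p n with p ℕ∣.∣? n
... | yes (divides q _) = suc (valuationFuel f p q)
... | no  _             = 0

-- Junk value: valuation p 0 = 0.
valuation : ℕ → ℕ → ℕ
valuation p n = valuationFuel n p n

-- As a relation, a valuation can be read off any factorisation of n, whatever `valuation` computes;
-- products of diagonal entries are treated in this way.
HasValuation : ℕ → ℕ → ℕ → Set
HasValuation p n e = ∃ λ u → n ≡ p ^ e * u × p ∤ℕ u

valuationFuel-has : ∀ f {p n} → .{{NonTrivial p}} → .{{NonZero n}} → n ≤ f →
                    HasValuation p n (valuationFuel f p n)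
valuationFuel-has zero {n = suc _} ()
valuationFuel-has (suc f) {p} {n} n≤f with p ℕ∣.∣? n
... | no p∤n = n , ≡.sym (ℕ.*-identityˡ n) , p∤n
... | yes (divides q ≡.refl) = extend (valuationFuel-has f (ℕ.≤-pred (ℕ.<-≤-trans q<n n≤f)))
  where
  instance
    q≢0 : NonZero q
    q≢0 = ℕ.m*n≢0⇒m≢0 q
  q<n : q < q * p
  q<n = ℕ.m<m*n q p (ℕ.nonTrivial⇒n>1 p)
  extend : HasValuation p q (valuationFuel f p q) → HasValuation p (q * p) (suc (valuationFuel f p q))
  extend (u , eq , p∤u) = u , (begin
    q * p                             ≡⟨ ℕ.*-comm q p ⟩
    p * q                             ≡⟨ ≡.cong (p *_) eq ⟩
    p * (p ^ valuationFuel f p q * u) ≡⟨ ℕ.*-assoc p _ u ⟨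
    p ^ suc (valuationFuel f p q) * u ∎) , p∤u
    where open ≡.≡-Reasoning

valuation-has : ∀ p n → .{{NonTrivial p}} → .{{NonZero n}} → HasValuation p n (valuation p n)
valuation-has p n = valuationFuel-has n ℕ.≤-refl

^-monoʳ-∣ : ∀ p {m n} → m ≤ n → p ^ m ∣ℕ p ^ n
^-monoʳ-∣ p {m} m≤n with ℕ.m≤n⇒∃[o]m+o≡n m≤n
... | o , ≡.refl = divides (p ^ o) (≡.trans (ℕ.^-distribˡ-+-* p m o) (ℕ.*-comm (p ^ m) (p ^ o)))

coprime-* : ∀ {a b c} → Coprime a c → Coprime b c → Coprime (a * b) c
coprime-* a⊥c b⊥c {d} (d∣ab , d∣c) = b⊥c (Coprimality.coprime-divisor d⊥a d∣ab , d∣c)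
  where
  d⊥a : Coprime d _
  d⊥a (e∣d , e∣a) = a⊥c (e∣a , ℕ∣.∣-trans e∣d d∣c)

coprime-^ : ∀ {a c} → Coprime a c → ∀ k → Coprime (a ^ k) c
coprime-^ a⊥c zero    = Coprimality.1-coprimeTo _
coprime-^ a⊥c (suc k) = coprime-* a⊥c (coprime-^ a⊥c k)

∈⇒∣product : ∀ {x xs} → x ∈ xs → x ∣ℕ product xs
∈⇒∣product {xs = _ ∷ xs} (here ≡.refl) = ℕ∣.m∣m*n (product xs)
∈⇒∣product {xs = y ∷ xs} (there x∈)  = ℕ∣.∣n⇒∣m*n y (∈⇒∣product x∈)

n<p^n : ∀ p .{{_ : NonTrivial p}} n → n < p ^ n
n<p^n p zero    = s≤s z≤n
n<p^n p (suc n) = ℕ.≤-<-trans (n<p^n p n)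
  (≡.subst (p ^ n <_) (ℕ.*-comm (p ^ n) p) (ℕ.m<m*n (p ^ n) p (ℕ.nonTrivial⇒n>1 p)))
  where instance _ = ℕ.m^n≢0 p n {{ℕ.nonTrivial⇒nonZero p}}

module _ {p : ℕ} (p-prime : Prime p) where

  private instance
    p≢0 : NonZero p
    p≢0 = prime⇒nonZero p-prime

  ∤⇒coprime : ∀ {n} → p ∤ℕ n → Coprime p n
  ∤⇒coprime p∤n (d∣p , d∣n) with prime⇒irreducible p-prime d∣p
  ... | inj₁ d≡1  = d≡1
  ... | inj₂ ≡.refl = contradiction d∣n p∤n

  -- If k exceeded e, then p ^ e * p would divide p ^ e * u, and cancelling p ^ e would give p ∣ u.
  ^∣⇒≤ : ∀ {n e k} → HasValuation p n e → p ^ k ∣ℕ n → k ≤ e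
  ^∣⇒≤ {e = e} {k} (u , ≡.refl , p∤u) p^k∣n with k ℕ.≤? e
  ... | yes k≤e = k≤e
  ... | no  k≰e = contradiction (ℕ∣.*-cancelˡ-∣ (p ^ e) {{ℕ.m^n≢0 p e}} (ℕ∣.∣-trans p^e*p∣p^k p^k∣n)) p∤u
    where
    p^e*p∣p^k : p ^ e * p ∣ℕ p ^ k
    p^e*p∣p^k = ≡.subst (_∣ℕ p ^ k) (ℕ.*-comm p (p ^ e)) (^-monoʳ-∣ p (ℕ.≰⇒> k≰e))

  valuation-mono : ∀ {m n e f} → HasValuation p m e → HasValuation p n f → m ∣ℕ n → e ≤ f
  valuation-mono {e = e} {f} (u , ≡.refl , _) has-f m∣n =
    ^∣⇒≤ {e = f} {e} has-f (ℕ∣.∣-trans (ℕ∣.m∣m*n u) m∣n)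

  valuation-* : ∀ {m n e f} → HasValuation p m e → HasValuation p n f → HasValuation p (m * n) (e + f)
  valuation-* {e = e} {f} (u , ≡.refl , p∤u) (v , ≡.refl , p∤v) = u * v , eq , λ p∣uv →
    [ p∤u , p∤v ]′ (euclidsLemma u v p-prime p∣uv)
    where
    eq : p ^ e * u * (p ^ f * v) ≡ p ^ (e + f) * (u * v)
    eq rewrite ℕ.^-distribˡ-+-* p e f = *-interchange (p ^ e) u (p ^ f) v

  -- This gcd is the number of elements of `ℤ/ n` killed by p ^ k, which is why `weight` truncates
  -- each part with ⊓.
  gcd-^ : ∀ {n e} → HasValuation p n e → ∀ k → gcd n (p ^ k) ≡ p ^ (e ⊓ k)
  gcd-^ {n} {e} (u , ≡.refl , p∤u) k with ℕ.≤-total k e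
  ... | inj₁ k≤e rewrite ℕ.m≥n⇒m⊓n≡n k≤e =
    ℕ∣.∣-antisym (gcd[m,n]∣n n (p ^ k))
                 (gcd-greatest (ℕ∣.∣m⇒∣m*n u (^-monoʳ-∣ p k≤e)) ℕ∣.∣-refl)
  ... | inj₂ e≤k rewrite ℕ.m≤n⇒m⊓n≡m e≤k with ℕ.m≤n⇒∃[o]m+o≡n e≤k
  ... | o , ≡.refl = begin
    gcd (p ^ e * u) (p ^ (e + o))     ≡⟨ ≡.cong (gcd (p ^ e * u)) (ℕ.^-distribˡ-+-* p e o) ⟩
    gcd (p ^ e * u) (p ^ e * p ^ o)   ≡⟨ c*gcd[m,n]≡gcd[cm,cn] (p ^ e) u (p ^ o) ⟨
    p ^ e * gcd u (p ^ o)             ≡⟨ ≡.cong (p ^ e *_) (Coprimality.coprime⇒gcd≡1 u⊥p^o) ⟩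
    p ^ e * 1                         ≡⟨ ℕ.*-identityʳ (p ^ e) ⟩
    p ^ e                             ∎
    where
    open ≡.≡-Reasoning
    u⊥p^o : Coprime u (p ^ o)
    u⊥p^o = Coprimality.sym (coprime-^ (∤⇒coprime p∤u) o)

valuation-unique : ∀ {p} → Prime p → ∀ {n e f} → HasValuation p n e → HasValuation p n f → e ≡ f
valuation-unique p-prime {e = e} {f} e-has f-has = ℕ.≤-antisym
  (valuation-mono p-prime {e = e} {f} e-has f-has ℕ∣.∣-refl)
  (valuation-mono p-prime {e = f} {e} f-has e-has ℕ∣.∣-refl)

distinct-primes-coprime : ∀ {p q} → Prime p → Prime q → p ≢ q → Coprime p q
distinct-primes-coprime p-prime q-prime p≢q = ∤⇒coprime p-prime λ p∣q →
  [ (λ { ≡.refl → ¬prime[1] p-prime }) , p≢q ]′ (prime⇒irreducible q-prime p∣q)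

prime-factor : ∀ n → .{{NonZero n}} → n ≢ 1 → ∃ λ p → Prime p × p ∣ℕ n
prime-factor n n≢1 with factorise n
... | record { factors = []    ; isFactorisation = n≡1 } = contradiction n≡1 n≢1
... | record { factors = p ∷ _ ; isFactorisation = ≡.refl ; factorsPrime = p-prime ∷ _ } =
  p , p-prime , ℕ∣.m∣m*n _

-- If a = ga′ with g = gcd a b, a prime p dividing a′ would give p · p^v(g) ∣ b.
∣-by-prime-powers : ∀ {a b} → .{{NonZero a}} →
  (∀ {p} → Prime p → ∀ k → p ^ k ∣ℕ a → p ^ k ∣ℕ b) → a ∣ℕ b
∣-by-prime-powers {a} {b} h with gcd[m,n]∣m a b | gcd[m,n]∣n a b
... | divides a′ a≡a′g | g∣b with a′ ℕ.≟ 1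
... | yes ≡.refl = ≡.subst (_∣ℕ b) (≡.trans (≡.sym (ℕ.*-identityˡ g)) (≡.sym a≡a′g)) g∣b
  where g = gcd a b
... | no a′≢1 = contradiction
  (^∣⇒≤ p-prime {e = e} {suc e} has-e (gcd-greatest p^1+e∣a (h p-prime (suc e) p^1+e∣a))) (ℕ.<⇒≱ ℕ.≤-refl)
  where
  g = gcd a b
  instance
    a′g≢0 : NonZero (a′ * g)
    a′g≢0 = ≡.subst NonZero a≡a′g (ℕ.≢-nonZero (ℕ.≢-nonZero⁻¹ a))
    a′≢0 : NonZero a′
    a′≢0 = ℕ.m*n≢0⇒m≢0 a′
    g≢0 : NonZero g
    g≢0 = ℕ.m*n≢0⇒n≢0 a′
  p = proj₁ (prime-factor a′ a′≢1)
  p-prime = proj₁ (proj₂ (prime-factor a′ a′≢1))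
  p∣a′ = proj₂ (proj₂ (prime-factor a′ a′≢1))
  instance
    p≥2 : NonTrivial p
    p≥2 = prime⇒nonTrivial p-prime
  e = valuation p g
  has-e : HasValuation p g e
  has-e = valuation-has p g
  p^1+e∣a : p ^ suc e ∣ℕ a
  p^1+e∣a = ≡.subst (p ^ suc e ∣ℕ_) (≡.sym a≡a′g)
    (ℕ∣.*-pres-∣ p∣a′ (≡.subst (p ^ e ∣ℕ_) (≡.sym (proj₁ (proj₂ has-e))) (ℕ∣.m∣m*n (proj₁ has-e))))

≡-by-valuations : ∀ {a b} → .{{NonZero a}} → .{{NonZero b}} →
  (∀ {p} → Prime p → ∃ λ e → HasValuation p a e × HasValuation p b e) → a ≡ b
≡-by-valuations h = ℕ∣.∣-antisym
  (∣-by-prime-powers λ {p} p-prime k p^k∣a → let e , ha , hb = h p-prime in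
    transfer {p} {e = e} hb (^∣⇒≤ p-prime {e = e} {k} ha p^k∣a))
  (∣-by-prime-powers λ {p} p-prime k p^k∣b → let e , ha , hb = h p-prime in
    transfer {p} {e = e} ha (^∣⇒≤ p-prime {e = e} {k} hb p^k∣b))
  where
  transfer : ∀ {p n e k} → HasValuation p n e → k ≤ e → p ^ k ∣ℕ n
  transfer {p} (u , ≡.refl , _) k≤e = ℕ∣.∣m⇒∣m*n u (^-monoʳ-∣ p k≤e)

private
  divides-prime? : ∀ n → Decidable (λ p → Prime p × p ∣ℕ n)
  divides-prime? n p = prime? p ×-dec p ℕ∣.∣? n

primeDivisors-unique : ∀ n → Unique (primeDivisors n)
primeDivisors-unique n = Unique.filter⁺ (divides-prime? n) (Unique.upTo⁺ (suc n))

∈-primeDivisors⁺ : ∀ {p n} → .{{NonZero n}} → Prime p → p ∣ℕ n → p ∈ primeDivisors n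
∈-primeDivisors⁺ {n = n} p-prime p∣n =
  ∈-filter⁺ (divides-prime? n) (∈-upTo⁺ (s≤s (ℕ∣.∣⇒≤ p∣n))) (p-prime , p∣n)

∈-primeDivisors⁻ : ∀ {p} n → p ∈ primeDivisors n → Prime p × p ∣ℕ n
∈-primeDivisors⁻ n p∈ = proj₂ (∈-filter⁻ (divides-prime? n) {xs = upTo (suc n)} p∈)

-- The exponent n is crude but uniform: p ^ k ∣ n gives k < p ^ k ≤ n. With one exponent for all
-- primes the product has the form that `primary-decomposition` expects.
∣-product-of-prime-powers : ∀ n → .{{NonZero n}} → n ∣ℕ product (map (_^ n) (primeDivisors n))
∣-product-of-prime-powers n = ∣-by-prime-powers λ where
  p-prime zero    _     → ℕ∣.1∣ _
  {p} p-prime k@(suc k-1) p^k∣n →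
    let instance _ = prime⇒nonTrivial p-prime
        k≤n = ℕ.≤-trans (ℕ.<⇒≤ (n<p^n p k)) (ℕ∣.∣⇒≤ p^k∣n)
        p∣n = ℕ∣.∣-trans (ℕ∣.m∣m*n (p ^ k-1)) p^k∣n
    in ℕ∣.∣-trans (^-monoʳ-∣ p k≤n) (∈⇒∣product (∈-map⁺ (_^ n) (∈-primeDivisors⁺ p-prime p∣n)))

private
  variable
    a b c d ℓ₁ ℓ₂ ℓ₃ ℓ₄ : Level
    G : AbelianGroup a ℓ₁
    H : AbelianGroup b ℓ₂
    K : AbelianGroup c ℓ₃

-- Isomorphisms of abelian groups

-- A presentation of G ≅ H as a record, so that G and H can be inferred.
record Iso (G : AbelianGroup a ℓ₁) (H : AbelianGroup b ℓ₂) : Set (a ⊔ˡ b ⊔ˡ ℓ₁ ⊔ˡ ℓ₂) where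
  private
    module G = AbelianGroup G
    module H = AbelianGroup H
  field
    to         : G.Carrier → H.Carrier
    cong       : ∀ {x y} → x G.≈ y → to x H.≈ to y
    homo       : ∀ x y → to (x G.∙ y) H.≈ to x H.∙ to y
    injective  : ∀ {x y} → to x H.≈ to y → x G.≈ y
    surjective : ∀ y → ∃ λ x → to x H.≈ y

  from : H.Carrier → G.Carrier
  from = proj₁ ∘ surjective

  to∘from : ∀ y → to (from y) H.≈ y
  to∘from = proj₂ ∘ surjective

  open AbelianGroupProperties H using (identityʳ-unique; inverseʳ-unique)

  ε-homo : to G.ε H.≈ H.ε
  ε-homo = identityʳ-unique (to G.ε) (to G.ε)
    (H.trans (H.sym (homo G.ε G.ε)) (cong (G.identityʳ G.ε)))

  ⁻¹-homo : ∀ x → to (x G.⁻¹) H.≈ to x H.⁻¹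
  ⁻¹-homo x = inverseʳ-unique (to x) (to (x G.⁻¹))
    (H.trans (H.sym (homo x (x G.⁻¹))) (H.trans (cong (G.inverseʳ x)) ε-homo))

Iso⇒≅ : Iso G H → G ≅ H
Iso⇒≅ {G = G} {H = H} φ = to , record
  { isGroupMonomorphism = record
    { isGroupHomomorphism = record
      { isMonoidHomomorphism = record
        { isMagmaHomomorphism = record
          { isRelHomomorphism = record { cong = cong }
          ; homo = homo
          }
        ; ε-homo = ε-homo
        }
      ; ⁻¹-homo = ⁻¹-homo
      }
    ; injective = injective
    }
  ; surjective = λ y → from y , λ z≈x → H.trans (cong z≈x) (to∘from y)
  }
  where
  open Iso φ
  module H = AbelianGroup H

≅⇒Iso : ∀ (G : AbelianGroup a ℓ₁) (H : AbelianGroup b ℓ₂) → G ≅ H → Iso G H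
≅⇒Iso G H (f , f-iso) = record
  { to         = f
  ; cong       = ⟦⟧-cong
  ; homo       = ∙-homo
  ; injective  = injective
  ; surjective = λ y → let x , eq = surjective y in x , eq (AbelianGroup.refl G)
  }
  where
  open GroupMorphisms (AbelianGroup.rawGroup G) (AbelianGroup.rawGroup H)
  open IsGroupIsomorphism f-iso

Iso-refl : Iso G G
Iso-refl {G = G} = record
  { to = id ; cong = id ; homo = λ _ _ → refl ; injective = id ; surjective = λ y → y , refl }
  where open AbelianGroup G using (refl)

Iso-sym : Iso G H → Iso H G
Iso-sym {G = G} {H = H} φ = record
  { to         = from
  ; cong       = λ {x} {y} x≈y → injective (trans (to∘from x) (trans x≈y (sym (to∘from y))))
  ; homo       = λ x y → injective (trans (to∘from _)
                   (sym (trans (homo _ _) (∙-cong (to∘from x) (to∘from y)))))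
  ; injective  = λ {x} {y} eq → trans (sym (to∘from x)) (trans (cong eq) (to∘from y))
  ; surjective = λ x → to x , injective (to∘from _)
  }
  where
  open Iso φ
  open AbelianGroup H using (trans; sym; ∙-cong)

Iso-trans : Iso G H → Iso H K → Iso G K
Iso-trans {K = K} φ ψ = record
  { to         = ψ.to ∘ φ.to
  ; cong       = ψ.cong ∘ φ.cong
  ; homo       = λ x y → trans (ψ.cong (φ.homo x y)) (ψ.homo _ _)
  ; injective  = φ.injective ∘ ψ.injective
  ; surjective = λ y → φ.from (ψ.from y) , trans (ψ.cong (φ.to∘from _)) (ψ.to∘from y)
  }
  where
  module φ = Iso φ
  module ψ = Iso ψ
  open AbelianGroup K using (trans)

-- The groups are explicit: inferring them from a ⊕ would unfold the product.
⊕-cong : ∀ (G : AbelianGroup a ℓ₁) (H : AbelianGroup b ℓ₂) (K : AbelianGroup c ℓ₃) (L : AbelianGroup d ℓ₄) →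
         Iso G H → Iso K L → Iso (G ⊕ K) (H ⊕ L)
⊕-cong _ _ _ _ φ ψ = record
  { to         = λ (x , y) → φ.to x , ψ.to y
  ; cong       = λ (p , q) → φ.cong p , ψ.cong q
  ; homo       = λ (x , y) (z , w) → φ.homo x z , ψ.homo y w
  ; injective  = λ (p , q) → φ.injective p , ψ.injective q
  ; surjective = λ (x , y) → (φ.from x , ψ.from y) , φ.to∘from x , ψ.to∘from y
  }
  where
  module φ = Iso φ
  module ψ = Iso ψ

⊕-congˡ : ∀ (G : AbelianGroup a ℓ₁) (H : AbelianGroup b ℓ₂) (K : AbelianGroup c ℓ₃) →
          Iso H K → Iso (G ⊕ H) (G ⊕ K)
⊕-congˡ G H K = ⊕-cong G G H K Iso-refl

IsTrivial : AbelianGroup a ℓ₁ → Set _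
IsTrivial G = ∀ x → x ≈ ε
  where open AbelianGroup G

trivial-iso : ∀ (G : AbelianGroup a ℓ₁) (H : AbelianGroup b ℓ₂) → IsTrivial G → IsTrivial H → Iso G H
trivial-iso G H G-trivial H-trivial = record
  { to         = λ _ → H.ε
  ; cong       = λ _ → H.refl
  ; homo       = λ _ _ → H.sym (H.identityʳ H.ε)
  ; injective  = λ {x} {y} _ → G.trans (G-trivial x) (G.sym (G-trivial y))
  ; surjective = λ y → G.ε , H.sym (H-trivial y)
  }
  where
  module G = AbelianGroup G
  module H = AbelianGroup H

⊕-trivialˡ : ∀ (G : AbelianGroup a ℓ₁) (H : AbelianGroup b ℓ₂) → IsTrivial G → Iso (G ⊕ H) H
⊕-trivialˡ G H G-trivial = record
  { to         = proj₂
  ; cong       = proj₂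
  ; homo       = λ _ _ → refl
  ; injective  = λ {(x , _)} {(y , _)} eq → G.trans (G-trivial x) (G.sym (G-trivial y)) , eq
  ; surjective = λ y → (G.ε , y) , refl
  }
  where
  module G = AbelianGroup G
  open AbelianGroup H using (refl)

⊕-swap : ∀ (G : AbelianGroup a ℓ₁) (H : AbelianGroup b ℓ₂) (K : AbelianGroup c ℓ₃) →
         Iso (G ⊕ H ⊕ K) (H ⊕ G ⊕ K)
⊕-swap G H K = record
  { to         = λ (x , y , z) → y , x , z
  ; cong       = λ (p , q , r) → q , p , r
  ; homo       = λ _ _ → AbelianGroup.refl H , AbelianGroup.refl G , AbelianGroup.refl K
  ; injective  = λ (p , q , r) → q , p , r
  ; surjective = λ (x , y , z) → (y , x , z) ,
      AbelianGroup.refl H , AbelianGroup.refl G , AbelianGroup.refl K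
  }

⊕-assoc : ∀ (G : AbelianGroup a ℓ₁) (H : AbelianGroup b ℓ₂) (K : AbelianGroup c ℓ₃) →
          Iso (G ⊕ H ⊕ K) ((G ⊕ H) ⊕ K)
⊕-assoc G H K = record
  { to         = λ (x , y , z) → (x , y) , z
  ; cong       = λ (p , q , r) → (p , q) , r
  ; homo       = λ _ _ → (AbelianGroup.refl G , AbelianGroup.refl H) , AbelianGroup.refl K
  ; injective  = λ ((p , q) , r) → p , q , r
  ; surjective = λ ((x , y) , z) → (x , y , z) ,
      (AbelianGroup.refl G , AbelianGroup.refl H) , AbelianGroup.refl K
  }

⨁-++ : ∀ Gs Hs → Iso (⨁ (Gs ++ Hs)) (⨁ Gs ⊕ ⨁ Hs)
⨁-++ []       Hs = Iso-sym (⊕-trivialˡ (⨁ []) (⨁ Hs) (λ _ → _))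
⨁-++ (G ∷ Gs) Hs = Iso-trans (⊕-congˡ G (⨁ (Gs ++ Hs)) (⨁ Gs ⊕ ⨁ Hs) (⨁-++ Gs Hs)) (⊕-assoc G (⨁ Gs) (⨁ Hs))

⨁-map-cong : ∀ {A : Set} {F F′ : A → AbelianGroup 0ℓ 0ℓ} xs →
             (∀ {x} → x ∈ xs → Iso (F x) (F′ x)) → Iso (⨁ (map F xs)) (⨁ (map F′ xs))
⨁-map-cong []       φ = Iso-refl
⨁-map-cong {F = F} {F′} (x ∷ xs) φ =
  ⊕-cong (F x) (F′ x) (⨁ (map F xs)) (⨁ (map F′ xs)) (φ (here ≡.refl)) (⨁-map-cong xs (φ ∘ there))

⨁-map-⊕ : ∀ {A : Set} (F F′ : A → AbelianGroup 0ℓ 0ℓ) xs →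
          Iso (⨁ (map (λ x → F x ⊕ F′ x) xs)) (⨁ (map F xs) ⊕ ⨁ (map F′ xs))
⨁-map-⊕ F F′ []       = Iso-sym (⊕-trivialˡ (⨁ []) (⨁ []) (λ _ → _))
⨁-map-⊕ F F′ (x ∷ xs) =
  Iso-trans (⊕-congˡ (F x ⊕ F′ x) (⨁ (map (λ x → F x ⊕ F′ x) xs)) (A ⊕ B) (⨁-map-⊕ F F′ xs)) (
  Iso-trans (Iso-sym (⊕-assoc (F x) (F′ x) (A ⊕ B))) (
  Iso-trans (⊕-congˡ (F x) (F′ x ⊕ A ⊕ B) (A ⊕ F′ x ⊕ B) (⊕-swap (F′ x) A B)) (
  ⊕-assoc (F x) A (F′ x ⊕ B))))
  where
  A = ⨁ (map F xs)
  B = ⨁ (map F′ xs)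

⨁-map-↭ : ∀ {A : Set} (F : A → AbelianGroup 0ℓ 0ℓ) {xs ys} → xs ↭ ys →
          Iso (⨁ (map F xs)) (⨁ (map F ys))
⨁-map-↭ F ↭.refl          = Iso-refl
⨁-map-↭ F (↭.prep {xs} {ys} x p) = ⊕-congˡ (F x) (⨁ (map F xs)) (⨁ (map F ys)) (⨁-map-↭ F p)
⨁-map-↭ F (↭.swap {xs} {ys} x y p) = Iso-trans (⊕-swap (F x) (F y) A) (
  ⊕-congˡ (F y) (F x ⊕ A) (F x ⊕ B) (⊕-congˡ (F x) A B (⨁-map-↭ F p)))
  where
  A = ⨁ (map F xs)
  B = ⨁ (map F ys)
⨁-map-↭ F (↭.trans p q)   = Iso-trans (⨁-map-↭ F p) (⨁-map-↭ F q)

ℤ/1-trivial : IsTrivial (ℤ/ 1)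
ℤ/1-trivial x = divides x (≡.trans (ℤ.+-identityʳ x) (≡.sym (ℤ.*-identityʳ x)))

-- Multiples and annihilators

module _ (G : AbelianGroup a ℓ₁) where
  infixr 8 _·_
  _·_ : ℕ → AbelianGroup.Carrier G → AbelianGroup.Carrier G
  _·_ = Mult._×_ (AbelianGroup.commutativeMonoid G)

module _ (φ : Iso G H) where
  private
    module G = AbelianGroup G
    module H = AbelianGroup H
  open Iso φ
  ·-homo : ∀ n x → to (_·_ G n x) H.≈ _·_ H n (to x)
  ·-homo zero    x = ε-homo
  ·-homo (suc n) x = H.trans (homo x _) (H.∙-congˡ (·-homo n x))

module Torsion (G : AbelianGroup a ℓ₁) where
  open AbelianGroup G renaming (refl to ≈-refl; sym to ≈-sym; trans to ≈-trans)
  open Mult commutativeMonoid renaming (_×_ to infixr 8 _·ᴳ_)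
  open SetoidReasoning setoid

  ·-ε : ∀ n → n ·ᴳ ε ≈ ε
  ·-ε zero    = ≈-refl
  ·-ε (suc n) = ≈-trans (identityˡ _) (·-ε n)

  ·-⁻¹ : ∀ n x → n ·ᴳ x ≈ ε → n ·ᴳ (x ⁻¹) ≈ ε
  ·-⁻¹ n x nx≈ε = begin
    n ·ᴳ (x ⁻¹)             ≈⟨ identityʳ _ ⟨
    n ·ᴳ (x ⁻¹) ∙ ε         ≈⟨ ∙-congˡ nx≈ε ⟨
    n ·ᴳ (x ⁻¹) ∙ n ·ᴳ x    ≈⟨ ×-distrib-+ (x ⁻¹) x n ⟨
    n ·ᴳ (x ⁻¹ ∙ x)         ≈⟨ ×-congʳ n (inverseˡ x) ⟩
    n ·ᴳ ε                  ≈⟨ ·-ε n ⟩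
    ε                       ∎

  ∣-annihilates : ∀ {m n x} → m ∣ℕ n → m ·ᴳ x ≈ ε → n ·ᴳ x ≈ ε
  ∣-annihilates {m} {x = x} (divides q ≡.refl) mx≈ε = begin
    (q * m) ·ᴳ x  ≈⟨ ×-assocˡ x q m ⟨
    q ·ᴳ m ·ᴳ x   ≈⟨ ×-congʳ q mx≈ε ⟩
    q ·ᴳ ε        ≈⟨ ·-ε q ⟩
    ε             ∎

  private
    -- Over ℕ, Bézout's identity for two coprime numbers reads 1 + m = n, with m a multiple of one
    -- of them and n of the other. The lemmas here are shaped for this equation, and the two
    -- constructors of `Bézout.Identity` decide which number stands on which side.
    shifted : ∀ {m n} x → suc m ≡ n → x ∙ m ·ᴳ x ≈ n ·ᴳ x
    shifted x ≡.refl = ≈-refl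

    bézout-trivial : ∀ {m n x} → suc m ≡ n → m ·ᴳ x ≈ ε → n ·ᴳ x ≈ ε → x ≈ ε
    bézout-trivial {m} {n} {x} eq mx≈ε nx≈ε = begin
      x             ≈⟨ identityʳ x ⟨
      x ∙ ε         ≈⟨ ∙-congˡ mx≈ε ⟨
      x ∙ m ·ᴳ x    ≈⟨ shifted x eq ⟩
      n ·ᴳ x        ≈⟨ nx≈ε ⟩
      ε             ∎

    bézout-split : ∀ {m n} x → suc m ≡ n → x ≈ (m ·ᴳ x) ⁻¹ ∙ n ·ᴳ x
    bézout-split {m} {n} x eq = begin
      x                                 ≈⟨ identityˡ x ⟨
      ε ∙ x                             ≈⟨ ∙-congʳ (inverseˡ (m ·ᴳ x)) ⟨
      (m ·ᴳ x) ⁻¹ ∙ m ·ᴳ x ∙ x          ≈⟨ assoc _ _ _ ⟩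
      (m ·ᴳ x) ⁻¹ ∙ (m ·ᴳ x ∙ x)        ≈⟨ ∙-congˡ (comm _ _) ⟩
      (m ·ᴳ x) ⁻¹ ∙ (x ∙ m ·ᴳ x)        ≈⟨ ∙-congˡ (shifted x eq) ⟩
      (m ·ᴳ x) ⁻¹ ∙ n ·ᴳ x              ∎

    module Multiples {m n} x (mnx≈ε : (m * n) ·ᴳ x ≈ ε) where
      multiple : ∀ w k l → m * n ∣ℕ k * l → l ·ᴳ (w * k) ·ᴳ x ≈ ε
      multiple w k l mn∣kl = ≈-trans (×-assocˡ x l (w * k)) (∣-annihilates
        (ℕ∣.∣-trans mn∣kl (divides w (≡.trans (ℕ.*-comm l (w * k)) (ℕ.*-assoc w k l)))) mnx≈ε)

      m-multiple : ∀ w → n ·ᴳ (w * m) ·ᴳ x ≈ ε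
      m-multiple w = multiple w m n ℕ∣.∣-refl

      n-multiple : ∀ w → m ·ᴳ (w * n) ·ᴳ x ≈ ε
      n-multiple w = multiple w n m (ℕ∣.∣-reflexive (ℕ.*-comm m n))

  coprime-annihilators : ∀ {m n x} → Coprime m n → m ·ᴳ x ≈ ε → n ·ᴳ x ≈ ε → x ≈ ε
  coprime-annihilators {m} {n} m⊥n mx≈ε nx≈ε with Coprimality.coprime-Bézout m⊥n
  ... | Bézout.Identity.+- u v eq = bézout-trivial eq
    (∣-annihilates (ℕ∣.n∣m*n v) nx≈ε) (∣-annihilates (ℕ∣.n∣m*n u) mx≈ε)
  ... | Bézout.Identity.-+ u v eq = bézout-trivial eq
    (∣-annihilates (ℕ∣.n∣m*n u) mx≈ε) (∣-annihilates (ℕ∣.n∣m*n v) nx≈ε)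

  -- Multiply x by 1 = um - vn: the summand -(vn)x is killed by m and (um)x by n, because mn kills
  -- x. The other case has the signs exchanged.
  coprime-split : ∀ {m n} x → Coprime m n → (m * n) ·ᴳ x ≈ ε →
                  ∃₂ λ y z → m ·ᴳ y ≈ ε × n ·ᴳ z ≈ ε × y ∙ z ≈ x
  coprime-split {m} {n} x m⊥n mnx≈ε with Coprimality.coprime-Bézout m⊥n
  ... | Bézout.Identity.+- u v eq =
    _ , _ , ·-⁻¹ m _ (n-multiple v) , m-multiple u , ≈-sym (bézout-split x eq)
    where open Multiples {m} {n} x mnx≈ε
  ... | Bézout.Identity.-+ u v eq =
    _ , _ , n-multiple v , ·-⁻¹ n _ (m-multiple u) , ≈-trans (comm _ _) (≈-sym (bézout-split x eq))
    where open Multiples {m} {n} x mnx≈ε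

-- Primary decomposition

module _ (G : AbelianGroup a ℓ₁) (H : AbelianGroup b ℓ₂) where
  private
    module G = AbelianGroup G
    module H = AbelianGroup H
  open AbelianGroupProperties H using (identityˡ-unique)
  open GroupProperties G.group using (x∙y⁻¹≈ε⇒x≈y)

  iso-by-kernel : (f : G.Carrier → H.Carrier) →
    (∀ {x y} → x G.≈ y → f x H.≈ f y) →
    (∀ x y → f (x G.∙ y) H.≈ f x H.∙ f y) →
    (∀ x → f x H.≈ H.ε → x G.≈ G.ε) →
    (∀ y → ∃ λ x → f x H.≈ y) →
    Iso G H
  iso-by-kernel f f-cong f-homo kernel surj = record
    { to = f ; cong = f-cong ; homo = f-homo ; surjective = surj
    ; injective = λ {x} {y} fx≈fy → x∙y⁻¹≈ε⇒x≈y x y (kernel _ (identityˡ-unique _ (f y) (begin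
        f (x G.∙ y G.⁻¹) H.∙ f y  ≈⟨ f-homo _ y ⟨
        f (x G.∙ y G.⁻¹ G.∙ y)    ≈⟨ f-cong (G.assoc x (y G.⁻¹) y) ⟩
        f (x G.∙ (y G.⁻¹ G.∙ y))  ≈⟨ f-cong (G.∙-congˡ (G.inverseˡ y)) ⟩
        f (x G.∙ G.ε)             ≈⟨ f-cong (G.identityʳ x) ⟩
        f x                       ≈⟨ fx≈fy ⟩
        f y                       ∎)))
    }
    where open SetoidReasoning H.setoid

module _ (G : AbelianGroup a ℓ₁) (A : ℕ → AbelianGroup 0ℓ 0ℓ) where
  open AbelianGroup G renaming (refl to ≈-refl; sym to ≈-sym; trans to ≈-trans)
  open Mult commutativeMonoid using (×-distrib-+; ×-congʳ)
  open AbelianGroupProperties G using (inverseˡ-unique)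
  open CommutativeSemigroupProperties commutativeSemigroup using (interchange)
  open Torsion G
  open SetoidReasoning setoid

  private
    infixr 8 _·ᴳ_
    _·ᴳ_ = _·_ G

    -- `⨁` takes only groups at level 0ℓ, whereas the primary components inherit the levels of G.
    -- The decomposition therefore runs over models `A p` at level 0ℓ.
    Component : ℕ → Set _
    Component p = Iso (A p) (primaryComponent p G)

  total : ∀ {ps} → All Component ps → AbelianGroup.Carrier (⨁ (map A ps)) → Carrier
  total []       _        = ε
  total (φ ∷ φs) (x , xs) = proj₁ (Iso.to φ x) ∙ total φs xs

  total-cong : ∀ {ps} (φs : All Component ps) {xs ys} →
               AbelianGroup._≈_ (⨁ (map A ps)) xs ys → total φs xs ≈ total φs ys
  total-cong []       _        = ≈-refl
  total-cong (φ ∷ φs) (p , ps) = ∙-cong (Iso.cong φ p) (total-cong φs ps)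

  total-homo : ∀ {ps} (φs : All Component ps) xs ys →
               total φs (AbelianGroup._∙_ (⨁ (map A ps)) xs ys) ≈ total φs xs ∙ total φs ys
  total-homo []       _        _        = ≈-sym (identityʳ ε)
  total-homo (φ ∷ φs) (x , xs) (y , ys) =
    ≈-trans (∙-cong (Iso.homo φ x y) (total-homo φs xs ys)) (interchange _ _ _ _)

  -- The annihilator m is a product of powers of the members of ps. Of this only its coprimality is
  -- recorded, as the kernel argument asks for no more.
  total-annihilated : ∀ {ps} (φs : All Component ps) xs → ∃ λ m →
    m ·ᴳ total φs xs ≈ ε × (∀ {q} → All (Coprime q) ps → Coprime m q)
  total-annihilated []       _        = 1 , identityʳ ε , λ _ → Coprimality.1-coprimeTo _
  total-annihilated (_∷_ {p} φ φs) (x , xs) =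
    let y , k , p^ky≈ε = Iso.to φ x
        m , mz≈ε , m⊥  = total-annihilated φs xs
    in p ^ k * m ,
       (begin
         (p ^ k * m) ·ᴳ (y ∙ total φs xs)
           ≈⟨ ×-distrib-+ y (total φs xs) (p ^ k * m) ⟩
         (p ^ k * m) ·ᴳ y ∙ (p ^ k * m) ·ᴳ total φs xs
           ≈⟨ ∙-cong (∣-annihilates {p ^ k} (ℕ∣.m∣m*n m) p^ky≈ε)
                     (∣-annihilates (ℕ∣.n∣m*n (p ^ k)) mz≈ε) ⟩
         ε ∙ ε
           ≈⟨ identityʳ ε ⟩
         ε ∎) ,
       λ { (q⊥p ∷ q⊥ps) → coprime-* (coprime-^ (Coprimality.sym q⊥p) k) (m⊥ q⊥ps) }

  -- If y comes from the p-component, z from the others, and y ∙ z ≈ ε, then y is the inverse of z.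
  -- So y is killed by a power of p and by a number coprime to p, and both y and z vanish.
  total-kernel : ∀ {ps} → AllPairs Coprime ps → (φs : All Component ps) → ∀ xs →
    total φs xs ≈ ε → AbelianGroup._≈_ (⨁ (map A ps)) xs (AbelianGroup.ε (⨁ (map A ps)))
  total-kernel []            []       _        _     = _
  total-kernel (p⊥ps ∷ ps⊥) (_∷_ {p} φ φs) (x , xs) yz≈ε =
    let y , k , p^ky≈ε = Iso.to φ x
        m , mz≈ε , m⊥  = total-annihilated φs xs
        z              = total φs xs
        my≈ε = begin
          m ·ᴳ y         ≈⟨ ×-congʳ m (inverseˡ-unique y z yz≈ε) ⟩
          m ·ᴳ (z ⁻¹)    ≈⟨ ·-⁻¹ m z mz≈ε ⟩
          ε              ∎
        y≈ε = coprime-annihilators {p ^ k} {m} (coprime-^ (Coprimality.sym (m⊥ p⊥ps)) k) p^ky≈ε my≈ε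
        z≈ε = begin
          z      ≈⟨ identityˡ z ⟨
          ε ∙ z  ≈⟨ ∙-congʳ y≈ε ⟨
          y ∙ z  ≈⟨ yz≈ε ⟩
          ε      ∎
    in Iso.injective φ (≈-trans y≈ε (≈-sym (Iso.ε-homo φ))) , total-kernel ps⊥ φs xs z≈ε

  -- Split x along the coprime factors p ^ k and the product of the remaining powers: the first part
  -- lies in the p-component, the second is left to the induction. For the empty list the product is
  -- 1, so x itself is ε.
  total-surjective : ∀ {ps} → AllPairs Coprime ps → (φs : All Component ps) → ∀ k x →
    product (map (_^ k) ps) ·ᴳ x ≈ ε → ∃ λ xs → total φs xs ≈ x
  total-surjective []           []       k x 1x≈ε = _ , ≈-trans (≈-sym 1x≈ε) (identityʳ x)
  total-surjective (_∷_ {p} {ps} p⊥ps ps⊥) (φ ∷ φs) k x kills =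
    let y , z , p^ky≈ε , kills-z , yz≈x = coprime-split {p ^ k} {product (map (_^ k) ps)} x
          (coprime-^ (Coprimality.sym (product-coprime ps p⊥ps)) k) kills
        xs , eq = total-surjective ps⊥ φs k z kills-z
    in (Iso.from φ (y , k , p^ky≈ε) , xs) ,
       ≈-trans (∙-cong (Iso.to∘from φ (y , k , p^ky≈ε)) eq) yz≈x
    where
    product-coprime : ∀ {p} ps → All (Coprime p) ps → Coprime (product (map (_^ k) ps)) p
    product-coprime []       []       = Coprimality.1-coprimeTo _
    product-coprime (q ∷ qs) (c ∷ cs) = coprime-* (coprime-^ (Coprimality.sym c) k) (product-coprime qs cs)

  primary-decomposition : ∀ {ps} → AllPairs Coprime ps → All Component ps →
    ∀ k → (∀ x → product (map (_^ k) ps) ·ᴳ x ≈ ε) → Iso (⨁ (map A ps)) G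
  primary-decomposition {ps} ps⊥ φs k kills = iso-by-kernel (⨁ (map A ps)) G
    (total φs) (total-cong φs) (total-homo φs) (total-kernel ps⊥ φs)
    (λ x → total-surjective ps⊥ φs k x (kills x))

primes-pairwise-coprime : ∀ {ps} → All Prime ps → Unique ps → AllPairs Coprime ps
primes-pairwise-coprime []                   []             = []
primes-pairwise-coprime (p-prime ∷ ps-prime) (p∉ps ∷ uniq) =
  All.zipWith {R = Coprime _} (λ (q-prime , p≢q) → distinct-primes-coprime p-prime q-prime p≢q)
    (ps-prime , p∉ps)
  ∷ primes-pairwise-coprime ps-prime uniq

primeDivisors-prime : ∀ n → All Prime (primeDivisors n)
primeDivisors-prime n = All.tabulate λ p∈ → proj₁ (∈-primeDivisors⁻ n p∈)

-- Finite abelian groups: annihilation by the order, and types at all primes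

module _ (G : FiniteAbelianGroup a ℓ₁) where
  open FiniteAbelianGroup G
  open Inverse enumeration using (to; from; to-cong; strictlyInverseˡ; strictlyInverseʳ)
  open AbelianGroupProperties abelianGroup using (identityˡ-unique)
  open Sum commutativeMonoid using (sum-permute; sum-cong-≋; ∑-distrib-+; sum-replicate)
    renaming (sum to sumᴳ)
  open SetoidReasoning setoid

  order-nonZero : NonZero order
  order-nonZero = Fin.nonZeroIndex (to ε)

  private
    translate : Carrier → Fin order → Fin order
    translate x i = to (x ∙ from i)

    translate-inverse : ∀ x y → x ∙ y ≈ ε → ∀ i → translate x (translate y i) ≡ i
    translate-inverse x y xy≈ε i = ≡.trans (to-cong (begin
      x ∙ from (to (y ∙ from i))  ≈⟨ ∙-congˡ (strictlyInverseʳ (y ∙ from i)) ⟩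
      x ∙ (y ∙ from i)            ≈⟨ assoc x y (from i) ⟨
      x ∙ y ∙ from i              ≈⟨ ∙-congʳ xy≈ε ⟩
      ε ∙ from i                  ≈⟨ identityˡ (from i) ⟩
      from i                      ∎)) (strictlyInverseˡ i)

    translation : Carrier → Permutation order order
    translation x = permutation (translate x) (translate (x ⁻¹))
      (translate-inverse x (x ⁻¹) (inverseʳ x)) (translate-inverse (x ⁻¹) x (inverseˡ x))

  -- Translation by x permutes G, hence fixes the sum of all elements.
  order-annihilates : ∀ x → _·_ abelianGroup order x ≈ ε
  order-annihilates x = identityˡ-unique _ (sumᴳ from) (sym (begin
    sumᴳ from                                   ≈⟨ sum-permute from (translation x) ⟩
    sumᴳ (λ i → from (translate x i))           ≈⟨ sum-cong-≋ (λ i → strictlyInverseʳ (x ∙ from i)) ⟩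
    sumᴳ (λ i → x ∙ from i)                     ≈⟨ ∑-distrib-+ (λ _ → x) from ⟩
    sumᴳ {order} (λ _ → x) ∙ sumᴳ from          ≈⟨ ∙-congʳ (sum-replicate order) ⟩
    _·_ abelianGroup order x ∙ sumᴳ from        ∎))

  module _ (types : ℕ → List ℕ) where
    -- `types p` is arbitrary when p does not divide the order.
    typeAt : ℕ → List ℕ
    typeAt p = if does (p ∈? primeDivisors order) then types p else []

    typeAt-∈ : ∀ {p} → p ∈ primeDivisors order → typeAt p ≡ types p
    typeAt-∈ {p} p∈ with p ∈? primeDivisors order
    ... | yes _  = ≡.refl
    ... | no  p∉ = contradiction p∈ p∉

    typeAt-∉ : ∀ {p} → p ∉ primeDivisors order → typeAt p ≡ []
    typeAt-∉ {p} p∉ with p ∈? primeDivisors order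
    ... | yes p∈ = contradiction p∈ p∉
    ... | no  _  = ≡.refl

    module _ (has-types : ∀ {p} → p ∈ primeDivisors order →
                          HasType p (primaryComponent p abelianGroup) (types p)) where

      primaryComponent-iso : ∀ {p} → Prime p → Iso (pGroup p (typeAt p)) (primaryComponent p abelianGroup)
      primaryComponent-iso {p} p-prime with p ∈? primeDivisors order
      ... | yes p∈ = Iso-sym (≅⇒Iso (primaryComponent p abelianGroup) (pGroup p (types p))
                           (proj₂ (has-types p∈)))
      -- Here p does not divide the order, so x is killed by the coprime numbers p ^ k and `order`.
      -- The component is trivial, in accordance with the empty type.
      ... | no  p∉ = trivial-iso (pGroup p []) (primaryComponent p abelianGroup) (λ _ → _)
        λ (x , k , p^kx≈ε) →
        Torsion.coprime-annihilators abelianGroup {p ^ k} {order}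
          (coprime-^ (∤⇒coprime p-prime (λ p∣n → p∉ (∈-primeDivisors⁺ {{order-nonZero}} p-prime p∣n))) k)
          p^kx≈ε (order-annihilates x)

      -- A multiple n of the order is allowed so that several groups can be split over the same
      -- primes; the additional primes contribute trivial summands.
      decomposition : ∀ n → .{{NonZero n}} → order ∣ℕ n →
        Iso (⨁ (map (λ p → pGroup p (typeAt p)) (primeDivisors n))) abelianGroup
      decomposition n order∣n = primary-decomposition abelianGroup (λ p → pGroup p (typeAt p))
        (primes-pairwise-coprime (primeDivisors-prime n) (primeDivisors-unique n))
        (All.map primaryComponent-iso (primeDivisors-prime n)) n
        (λ x → Torsion.∣-annihilates abelianGroup
          (ℕ∣.∣-trans order∣n (∣-product-of-prime-powers n)) (order-annihilates x))

private
  variable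
    m n k l : ℕ

-- Counting torsion

-- Cardinality is taken modulo the equality of the group, hence as an enumeration without
-- repetition. By the pigeonhole principle the number k is determined by G and n.
record TorsionCount (G : AbelianGroup a ℓ₁) (n k : ℕ) : Set (a ⊔ˡ ℓ₁) where
  open AbelianGroup G
  field
    element     : Fin k → Carrier
    annihilated : ∀ i → _·_ G n (element i) ≈ ε
    injective   : ∀ {i j} → element i ≈ element j → i ≡ j
    surjective  : ∀ x → _·_ G n x ≈ ε → ∃ λ i → element i ≈ x

torsionCount-unique : TorsionCount G n k → TorsionCount G n l → k ≡ l
torsionCount-unique {G = G} S T = ℕ.≤-antisym (≤-count S T) (≤-count T S)
  where
  open AbelianGroup G
  ≤-count : TorsionCount G n k → TorsionCount G n l → k ≤ l
  ≤-count S T = Fin.injective⇒≤ {f = λ i → proj₁ (index i)} λ {i} {j} eq →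
    S.injective (trans (sym (proj₂ (index i))) (trans (reflexive (≡.cong T.element eq)) (proj₂ (index j))))
    where
    module S = TorsionCount S
    module T = TorsionCount T
    index = λ i → T.surjective (S.element i) (S.annihilated i)

torsionCount-iso : Iso G H → TorsionCount G n k → TorsionCount H n k
torsionCount-iso {G = G} {H = H} {n = n} φ T = record
  { element     = to ∘ element
  ; annihilated = λ i → H.trans (H.sym (·-homo φ n (element i))) (H.trans (cong (annihilated i)) ε-homo)
  ; injective   = T.injective ∘ injective
  ; surjective  = λ y ny≈ε →
      let i , eq = T.surjective (from y) (injective (H.trans (·-homo φ n (from y))
                     (H.trans (Mult.×-congʳ H.commutativeMonoid n (to∘from y)) (H.trans ny≈ε (H.sym ε-homo)))))
      in i , H.trans (cong eq) (to∘from y)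
  }
  where
  open Iso φ
  module H = AbelianGroup H
  module T = TorsionCount T
  open T using (element; annihilated)

·-⊕ : ∀ (G : AbelianGroup a ℓ₁) (H : AbelianGroup b ℓ₂) n x y →
      _·_ (G ⊕ H) n (x , y) ≡ (_·_ G n x , _·_ H n y)
·-⊕ G H zero    x y = ≡.refl
·-⊕ G H (suc n) x y = ≡.cong (AbelianGroup._∙_ (G ⊕ H) (x , y)) (·-⊕ G H n x y)

torsionCount-⊕ : ∀ (G : AbelianGroup a ℓ₁) (H : AbelianGroup b ℓ₂) →
                 TorsionCount G n k → TorsionCount H n l → TorsionCount (G ⊕ H) n (k * l)
torsionCount-⊕ {n = n} {k = k} {l = l} G H S T = record
  { element     = λ i → S.element (quotient i) , T.element (remainder i)
  ; annihilated = λ i → ≡.subst (_≈ ε) (≡.sym (·-⊕ G H n _ _)) (S.annihilated _ , T.annihilated _)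
  ; injective   = λ {i} {j} (p , q) → ≡.trans (≡.sym (Fin.combine-remQuot {k} l i)) (≡.trans
      (≡.cong₂ combine (S.injective p) (T.injective q)) (Fin.combine-remQuot {k} l j))
  ; surjective  = λ (x , y) nxy≈ε →
      let nx≈ε , ny≈ε = ≡.subst (_≈ ε) (·-⊕ G H n x y) nxy≈ε
          i , p = S.surjective x nx≈ε
          j , q = T.surjective y ny≈ε
          eq    = Fin.remQuot-combine i j
      in combine i j , G.trans (G.reflexive (≡.cong (S.element ∘ proj₁) eq)) p
                     , H.trans (H.reflexive (≡.cong (T.element ∘ proj₂) eq)) q
  }
  where
  open AbelianGroup (G ⊕ H) using (_≈_; ε)
  module G = AbelianGroup G
  module H = AbelianGroup H
  module S = TorsionCount S
  module T = TorsionCount T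
  quotient  = λ (i : Fin (k * l)) → proj₁ (remQuot l i)
  remainder = λ (i : Fin (k * l)) → proj₂ (remQuot {k} l i)

torsionCount-terminal : ∀ n → TorsionCount (⨁ []) n 1
torsionCount-terminal n = record
  { element     = λ _ → _
  ; annihilated = λ _ → _
  ; injective   = λ { {zero} {zero} _ → ≡.refl }
  ; surjective  = λ _ _ → zero , _
  }

·-ℤ/ : ∀ m n x → _·_ (ℤ/ m) n x ≡ + n ℤ.* x
·-ℤ/ m zero    x = ≡.sym (ℤ.*-zeroˡ x)
·-ℤ/ m (suc n) x = ≡.trans (≡.cong (λ y → x ℤ.+ y) (·-ℤ/ m n x)) (≡.sym (ℤ.suc-* (+ n) x))

∣∧<⇒≡0 : m ∣ℕ n → n < m → n ≡ 0
∣∧<⇒≡0 {n = zero}  _   _   = ≡.refl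
∣∧<⇒≡0 {n = suc _} m∣n n<m = contradiction m∣n (ℕ∣.>⇒∤ n<m)

-- The n-torsion of ℤ/ m is generated by u = m / gcd m n.
torsionCount-ℤ/ : ∀ u v g .{{_ : NonZero u}} .{{_ : NonZero g}} → Coprime u v →
                  m ≡ u * g → n ≡ v * g → TorsionCount (ℤ/ m) n g
torsionCount-ℤ/ u v g u⊥v ≡.refl ≡.refl = record
  { element     = element
  ; annihilated = annihilated
  ; injective   = λ {i} {j} → injective {i} {j}
  ; surjective  = surjective
  }
  where
  open ≡.≡-Reasoning
  element : Fin g → ℤ
  element i = + (u * toℕ i)

  swap-factors : ∀ u v g i → v * g * (u * i) ≡ v * i * (u * g)
  swap-factors = ℕ-Solver.solve-∀

  annihilated : ∀ i → + (u * g) ∣ℤ _·_ (ℤ/ (u * g)) (v * g) (element i) ℤ.- ℤ.0ℤ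
  annihilated i = ≡.subst (+ (u * g) ∣ℤ_) (begin
    + (v * g * (u * toℕ i))                            ≡⟨ ℤ.pos-* (v * g) (u * toℕ i) ⟩
    + (v * g) ℤ.* element i                            ≡⟨ ·-ℤ/ (u * g) (v * g) (element i) ⟨
    _·_ (ℤ/ (u * g)) (v * g) (element i)               ≡⟨ ℤ.+-identityʳ _ ⟨
    _·_ (ℤ/ (u * g)) (v * g) (element i) ℤ.- ℤ.0ℤ      ∎)
    (∣ᵤ⇒∣ (ℕ∣.divides (v * toℕ i) (swap-factors u v g (toℕ i))))

  factor : ∀ u i j → u ℤ.* i ℤ.- u ℤ.* j ≡ u ℤ.* (i ℤ.- j)
  factor = solve-∀

  injective : ∀ {i j} → + (u * g) ∣ℤ element i ℤ.- element j → i ≡ j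
  -- Cancelling u leaves g ∣ i - j, while |i - j| < g because both indices are below g.
  injective {i} {j} ug∣ = Fin.toℕ-injective (ℤ.+-injective (ℤ.i-j≡0⇒i≡j (+ toℕ i) (+ toℕ j)
    (ℤ.∣i∣≡0⇒i≡0 (∣∧<⇒≡0 (ℕ∣.*-cancelˡ-∣ u (≡.subst (u * g ∣ℕ_) abs-eq (∣⇒∣ᵤ ug∣))) abs<g))))
    where
    abs-eq : ℤ.∣ element i ℤ.- element j ∣ ≡ u * ℤ.∣ + toℕ i ℤ.- + toℕ j ∣
    abs-eq = begin
      ℤ.∣ + (u * toℕ i) ℤ.- + (u * toℕ j) ∣
        ≡⟨ ≡.cong₂ (λ x y → ℤ.∣ x ℤ.- y ∣) (ℤ.pos-* u (toℕ i)) (ℤ.pos-* u (toℕ j)) ⟩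
      ℤ.∣ + u ℤ.* + toℕ i ℤ.- + u ℤ.* + toℕ j ∣  ≡⟨ ≡.cong ℤ.∣_∣ (factor (+ u) (+ toℕ i) (+ toℕ j)) ⟩
      ℤ.∣ + u ℤ.* (+ toℕ i ℤ.- + toℕ j) ∣        ≡⟨ ℤ.abs-* (+ u) _ ⟩
      u * ℤ.∣ + toℕ i ℤ.- + toℕ j ∣              ∎

    abs<g : ℤ.∣ + toℕ i ℤ.- + toℕ j ∣ < g
    abs<g rewrite ℤ.m-n≡m⊖n (toℕ i) (toℕ j) =
      ℕ.≤-<-trans (ℤ.∣m⊝n∣≤m⊔n (toℕ i) (toℕ j)) (ℕ.⊔-pres-<m (Fin.toℕ<n i) (Fin.toℕ<n j))

  surjective : ∀ x → + (u * g) ∣ℤ _·_ (ℤ/ (u * g)) (v * g) x ℤ.- ℤ.0ℤ →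
               ∃ λ i → + (u * g) ∣ℤ element i ℤ.- x
  -- From u g ∣ v g x follows u ∣ v x, and then u ∣ x by coprimality.
  surjective x ug∣ with ∣ᵤ⇒∣ {+ u} {x} (Coprimality.coprime-divisor u⊥v u∣v∣x∣)
    where
    u∣v∣x∣ : u ∣ℕ v * ℤ.∣ x ∣
    u∣v∣x∣ = ℕ∣.*-cancelʳ-∣ g (≡.subst (u * g ∣ℕ_) (begin
      ℤ.∣ _·_ (ℤ/ (u * g)) (v * g) x ℤ.- ℤ.0ℤ ∣
        ≡⟨ ≡.cong ℤ.∣_∣ (ℤ.+-identityʳ (_·_ (ℤ/ (u * g)) (v * g) x)) ⟩
      ℤ.∣ _·_ (ℤ/ (u * g)) (v * g) x ∣           ≡⟨ ≡.cong ℤ.∣_∣ (·-ℤ/ (u * g) (v * g) x) ⟩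
      ℤ.∣ + (v * g) ℤ.* x ∣                      ≡⟨ ℤ.abs-* (+ (v * g)) x ⟩
      v * g * ℤ.∣ x ∣                            ≡⟨ regroup v g ℤ.∣ x ∣ ⟩
      v * ℤ.∣ x ∣ * g                            ∎) (∣⇒∣ᵤ ug∣))
      where
      regroup : ∀ v g x → v * g * x ≡ v * x * g
      regroup = ℕ-Solver.solve-∀
  -- Now x = q u. The index is the remainder of q modulo g: passing from q to it changes x by a
  -- multiple of u g, which is zero in the group.
  ... | divides q ≡.refl = fromℕ< (n%ℕd<d q g) , divides (ℤ.- s) (begin
    + (u * toℕ (fromℕ< (n%ℕd<d q g))) ℤ.- q ℤ.* + u
      ≡⟨ ≡.cong (λ j → + (u * j) ℤ.- q ℤ.* + u) (Fin.toℕ-fromℕ< (n%ℕd<d q g)) ⟩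
    + (u * r) ℤ.- q ℤ.* + u
      ≡⟨ ≡.cong₂ (λ y z → y ℤ.- z ℤ.* + u) (ℤ.pos-* u r) (a≡a%ℕn+[a/ℕn]*n q g) ⟩
    + u ℤ.* + r ℤ.- (+ r ℤ.+ s ℤ.* + g) ℤ.* + u
      ≡⟨ cancel (+ u) (+ r) s (+ g) ⟩
    ℤ.- s ℤ.* (+ u ℤ.* + g)
      ≡⟨ ≡.cong (ℤ.- s ℤ.*_) (ℤ.pos-* u g) ⟨
    ℤ.- s ℤ.* + (u * g) ∎)
    where
    r = q %ℕ g
    s = q /ℕ g
    cancel : ∀ u r s g → u ℤ.* r ℤ.- (r ℤ.+ s ℤ.* g) ℤ.* u ≡ ℤ.- s ℤ.* (u ℤ.* g)
    cancel = solve-∀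

torsionCount-cyclic : ∀ m n .{{_ : NonZero m}} → TorsionCount (ℤ/ m) n (gcd m n)
torsionCount-cyclic m n with gcd m n | gcd[m,n]∣m m n | gcd[m,n]∣n m n | gcd-GCD m n
... | g | ℕ∣.divides u ≡.refl | ℕ∣.divides v ≡.refl | is-gcd =
  torsionCount-ℤ/ u v g {{ℕ.m*n≢0⇒m≢0 u {g}}} {{g≢0}} (Coprimality.GCD≡1⇒coprime (GCD-* {{g≢0}}
    (≡.subst (GCD (u * g) (v * g)) (≡.sym (ℕ.*-identityˡ g)) is-gcd))) ≡.refl ≡.refl
  where
  g≢0 : NonZero g
  g≢0 = ℕ.m*n≢0⇒n≢0 u {g}

^-injectiveʳ : ∀ {p} → 1 < p → ∀ {m n} → p ^ m ≡ p ^ n → m ≡ n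
^-injectiveʳ {p} 1<p {m} {n} eq with ℕ.<-cmp m n
... | tri< m<n _ _ = contradiction eq (ℕ.<⇒≢ (ℕ.^-monoʳ-< p 1<p m<n))
... | tri≈ _ m≡n _ = m≡n
... | tri> _ _ n<m = contradiction (≡.sym eq) (ℕ.<⇒≢ (ℕ.^-monoʳ-< p 1<p n<m))

^-hasValuation : ∀ {p} → Prime p → ∀ i → HasValuation p (p ^ i) i
^-hasValuation {p} p-prime i = 1 , ≡.sym (ℕ.*-identityʳ (p ^ i)) , λ p∣1 →
  ¬prime[1] (≡.subst Prime (ℕ∣.∣1⇒≡1 p∣1) p-prime)

torsionCount-cyclic-^ : ∀ {p} → Prime p → ∀ {d e} .{{_ : NonZero d}} → HasValuation p d e →
  ∀ k → TorsionCount (ℤ/ d) (p ^ k) (p ^ (e ⊓ k))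
torsionCount-cyclic-^ {p} p-prime {d} {e} has k =
  ≡.subst (TorsionCount (ℤ/ d) (p ^ k)) (gcd-^ p-prime {e = e} has k) (torsionCount-cyclic d (p ^ k))

torsionCount-pGroup : ∀ {p} → Prime p → ∀ k xs → TorsionCount (pGroup p xs) (p ^ k) (p ^ weight k xs)
torsionCount-pGroup p-prime k []       = torsionCount-terminal _
torsionCount-pGroup {p} p-prime k (x ∷ xs) =
  ≡.subst (TorsionCount (pGroup p (x ∷ xs)) (p ^ k)) (≡.sym (ℕ.^-distribˡ-+-* p (x ⊓ k) (weight k xs)))
    (torsionCount-⊕ (ℤ/ (p ^ x)) (pGroup p xs)
      (torsionCount-cyclic-^ p-prime {e = x} {{ℕ.m^n≢0 p x {{prime⇒nonZero p-prime}}}}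
        (^-hasValuation p-prime x) k)
      (torsionCount-pGroup p-prime k xs))

torsionCount-pGroup-≢ : ∀ {p q} → Prime p → Prime q → p ≢ q → ∀ k xs → TorsionCount (pGroup q xs) (p ^ k) 1
torsionCount-pGroup-≢ p-prime q-prime p≢q k []       = torsionCount-terminal _
torsionCount-pGroup-≢ {p} {q} p-prime q-prime p≢q k (x ∷ xs) =
  torsionCount-⊕ (ℤ/ (q ^ x)) (pGroup q xs)
    (≡.subst (TorsionCount (ℤ/ (q ^ x)) (p ^ k)) (Coprimality.coprime⇒gcd≡1 q^x⊥p^k)
      (torsionCount-cyclic (q ^ x) (p ^ k) {{ℕ.m^n≢0 q x {{prime⇒nonZero q-prime}}}}))
    (torsionCount-pGroup-≢ p-prime q-prime p≢q k xs)
  where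
  q^x⊥p^k : Coprime (q ^ x) (p ^ k)
  q^x⊥p^k = coprime-^ (Coprimality.sym (coprime-^ (distinct-primes-coprime p-prime q-prime p≢q) k)) x

module _ {p} (p-prime : Prime p) (types : ℕ → List ℕ) (k : ℕ) where
  private
    components : List ℕ → AbelianGroup 0ℓ 0ℓ
    components ps = ⨁ (map (λ q → pGroup q (types q)) ps)

  torsionCount-⨁-∉ : ∀ {ps} → All Prime ps → p ∉ ps → TorsionCount (components ps) (p ^ k) 1
  torsionCount-⨁-∉ []                               p∉ = torsionCount-terminal _
  torsionCount-⨁-∉ (_∷_ {q} {qs} q-prime qs-prime) p∉ = torsionCount-⊕ (pGroup q (types q)) (components qs)
    (torsionCount-pGroup-≢ p-prime q-prime (p∉ ∘ here) k (types q)) (torsionCount-⨁-∉ qs-prime (p∉ ∘ there))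

  torsionCount-⨁-∈ : ∀ {ps} → All Prime ps → Unique ps → p ∈ ps →
    TorsionCount (components ps) (p ^ k) (p ^ weight k (types p))
  torsionCount-⨁-∈ (_∷_ {xs = qs} _ qs-prime) (p≢qs ∷ _) (here ≡.refl) =
    ≡.subst (TorsionCount (components (p ∷ qs)) (p ^ k)) (ℕ.*-identityʳ _)
      (torsionCount-⊕ (pGroup p (types p)) (components qs)
        (torsionCount-pGroup p-prime k (types p))
        (torsionCount-⨁-∉ qs-prime λ p∈ → All.lookup p≢qs p∈ ≡.refl))
  torsionCount-⨁-∈ (_∷_ {q} {qs} q-prime qs-prime) (q≢qs ∷ uniq) (there p∈) =
    ≡.subst (TorsionCount (components (q ∷ qs)) (p ^ k)) (ℕ.*-identityˡ _)
      (torsionCount-⊕ (pGroup q (types q)) (components qs)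
        (torsionCount-pGroup-≢ p-prime q-prime (λ { ≡.refl → All.lookup q≢qs p∈ ≡.refl }) k (types q))
        (torsionCount-⨁-∈ qs-prime uniq p∈))

  -- Summands at primes other than p have no p ^ k-torsion except zero. If p is not listed, the
  -- empty type has weight 0 and the formula still gives the right count, p ^ 0 = 1.
  torsionCount-⨁ : ∀ {ps} → All Prime ps → Unique ps → (p ∉ ps → types p ≡ []) →
    TorsionCount (components ps) (p ^ k) (p ^ weight k (types p))
  torsionCount-⨁ {ps} ps-prime uniq empty with p ∈? ps
  ... | yes p∈ = torsionCount-⨁-∈ ps-prime uniq p∈
  ... | no  p∉ rewrite empty p∉ = torsionCount-⨁-∉ ps-prime p∉

-- The p ^ k-torsion of a cyclic group sees only the p-adic valuation of its order, so the list of
-- valuations takes the place of a type.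
torsionCount-invariantFactors : ∀ {p} → Prime p → ∀ k {r} {ds : Vec ℕ r} → VecAll.All NonZero ds →
  TorsionCount (⨁ (map ℤ/_ (toList ds))) (p ^ k) (p ^ weight k (toList (Vec.map (valuation p) ds)))
torsionCount-invariantFactors p-prime k VecAll.[] = torsionCount-terminal _
torsionCount-invariantFactors {p} p-prime k (VecAll._∷_ {x = d} {xs = ds} d≢0 ds≢0) =
  ≡.subst (TorsionCount (⨁ (map ℤ/_ (d ∷ toList ds))) (p ^ k))
    (≡.sym (ℕ.^-distribˡ-+-* p (valuation p d ⊓ k) (weight k (toList (Vec.map (valuation p) ds)))))
    (torsionCount-⊕ (ℤ/ d) (⨁ (map ℤ/_ (toList ds)))
      (torsionCount-cyclic-^ p-prime {e = valuation p d} {{d≢0}}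
        (valuation-has p d {{prime⇒nonTrivial p-prime}} {{d≢0}}) k)
      (torsionCount-invariantFactors p-prime k ds≢0))

-- Equal counts give isomorphic p-groups

pGroup-++ : ∀ p xs ys → Iso (pGroup p (xs ++ ys)) (pGroup p xs ⊕ pGroup p ys)
pGroup-++ p xs ys rewrite map-++ (λ i → ℤ/ (p ^ i)) xs ys = ⨁-++ (map (λ i → ℤ/ (p ^ i)) xs) _

count-↭ : ∀ {xs ys} k → xs ↭ ys → count k xs ≡ count k ys
count-↭ k xs↭ys = ↭-length (filter-↭ (suc k ℕ.≤?_) xs↭ys)

-- The drop in the count from i to i + 1 is the multiplicity of the part i + 1.
count-drop⇒∈ : ∀ {i} xs → count (suc i) xs < count i xs → suc i ∈ xs
count-drop⇒∈ {i} (x ∷ xs) drop with ℕ.<-cmp x (suc i)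
... | tri< x≤i _ _ rewrite count-∷-≤ xs (ℕ.≤-pred x≤i) | count-∷-≤ xs (ℕ.<⇒≤ x≤i) =
  there (count-drop⇒∈ xs drop)
... | tri≈ _ x≡ _ = here (≡.sym x≡)
... | tri> _ _ i<x rewrite count-∷-< xs i<x | count-∷-< xs (ℕ.<⇒≤ i<x) =
  there (count-drop⇒∈ xs (ℕ.≤-pred drop))

count-∷-cancel : ∀ {k} x xs ys → count k (x ∷ xs) ≡ count k (x ∷ ys) → count k xs ≡ count k ys
count-∷-cancel {k} x xs ys eq with x ℕ.≤? k
... | yes x≤k rewrite count-∷-≤ xs x≤k | count-∷-≤ ys x≤k = eq
... | no  x≰k rewrite count-∷-< xs (ℕ.≰⇒> x≰k) | count-∷-< ys (ℕ.≰⇒> x≰k) = ℕ.suc-injective eq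

pGroup-trivial : ∀ p xs → count 0 xs ≡ 0 → IsTrivial (pGroup p xs)
pGroup-trivial p []           _  _        = _
pGroup-trivial p (zero ∷ xs)  eq (y , ys) = ℤ/1-trivial y , pGroup-trivial p xs eq ys
pGroup-trivial p (suc x ∷ xs) ()

-- A zero part is a trivial summand and can be discarded. A positive part of xs makes the counts
-- drop, so it occurs in ys too; removing it from both lists keeps the counts equal.
pGroup-iso : ∀ p xs ys → (∀ k → count k xs ≡ count k ys) → Iso (pGroup p xs) (pGroup p ys)
pGroup-iso p []           ys eq =
  trivial-iso (pGroup p []) (pGroup p ys) (λ _ → _) (pGroup-trivial p ys (≡.sym (eq 0)))
pGroup-iso p (zero ∷ xs)  ys eq =
  Iso-trans (⊕-trivialˡ (ℤ/ 1) (pGroup p xs) ℤ/1-trivial)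
    (pGroup-iso p xs ys λ k → ≡.trans (≡.sym (count-∷-≤ xs ℕ.z≤n)) (eq k))
pGroup-iso p (suc x ∷ xs) ys eq with ∈-∃++ (count-drop⇒∈ {x} ys drop)
  where
  drop : count (suc x) ys < count x ys
  drop rewrite ≡.sym (eq (suc x)) | ≡.sym (eq x)
             | count-∷-≤ xs (ℕ.≤-refl {suc x}) | count-∷-< xs (ℕ.≤-refl {suc x}) =
    s≤s (count-antitone (ℕ.n≤1+n x) xs)
... | us , vs , ≡.refl = Iso-trans
  (⊕-congˡ (ℤ/ (p ^ suc x)) (pGroup p xs) (pGroup p (us ++ vs)) (pGroup-iso p xs (us ++ vs) λ k →
    count-∷-cancel (suc x) xs (us ++ vs) (≡.trans (eq k) (count-↭ k (shift (suc x) us vs)))))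
  (Iso-sym (⨁-map-↭ (λ i → ℤ/ (p ^ i)) (shift (suc x) us vs)))

-- Smith normal forms

partialProducts-nonZero : ∀ {r} {ns : Vec ℕ r} →
                          VecAll.All NonZero ns → VecAll.All NonZero (partialProducts ns)
partialProducts-nonZero VecAll.[] = VecAll.[]
partialProducts-nonZero (VecAll._∷_ {x = n} n≢0 ns≢0) =
  n≢0 VecAll.∷ map-nonZero (partialProducts-nonZero ns≢0)
  where
  map-nonZero : ∀ {r} {ds : Vec ℕ r} → VecAll.All NonZero ds → VecAll.All NonZero (Vec.map (n *_) ds)
  map-nonZero VecAll.[] = VecAll.[]
  map-nonZero (VecAll._∷_ {x = d} d≢0 ds≢0) = ℕ.m*n≢0 n d {{n≢0}} {{d≢0}} VecAll.∷ map-nonZero ds≢0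

partialProducts-∣ : ∀ {r} (ns : Vec ℕ r) i j → i Fin.≤ j →
  lookup (partialProducts ns) i ∣ℕ lookup (partialProducts ns) j
partialProducts-∣ (n ∷ ns) zero    zero    _   = ℕ∣.∣-refl
partialProducts-∣ (n ∷ ns) zero    (suc j) _   rewrite lookup-map j (n *_) (partialProducts ns) = ℕ∣.m∣m*n _
partialProducts-∣ (n ∷ ns) (suc i) (suc j) i≤j
  rewrite lookup-map i (n *_) (partialProducts ns) | lookup-map j (n *_) (partialProducts ns) =
  ℕ∣.*-monoʳ-∣ n (partialProducts-∣ ns i j (ℕ.≤-pred i≤j))

diag-≡ : ∀ {r} (ds : Vec ℕ r) i → diag ds i i ≡ + lookup ds i
diag-≡ ds i with i Fin.≟ i
... | yes _   = ≡.refl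
... | no  i≢i = contradiction ≡.refl i≢i

diag-≢ : ∀ {r} (ds : Vec ℕ r) {i j} → i ≢ j → diag ds i j ≡ ℤ.0ℤ
diag-≢ ds {i} {j} i≢j with i Fin.≟ j
... | yes i≡j = contradiction i≡j i≢j
... | no  _   = ≡.refl

open Sum ℤ.+-0-commutativeMonoid using ()
  renaming (sum to sumℤ; sum-remove to sumℤ-remove; sum-cong-≋ to sumℤ-cong; sum-replicate-zero to sumℤ-zero)

sum-single : ∀ {r} (t : Vector ℤ r) i → (∀ k → k ≢ i → t k ≡ ℤ.0ℤ) → sumℤ t ≡ t i
sum-single {suc r} t i zeros = begin
  sumℤ t                                          ≡⟨ sumℤ-remove {i = i} t ⟩
  t i ℤ.+ sumℤ (λ k → t (Fin.punchIn i k))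
    ≡⟨ ≡.cong (λ x → t i ℤ.+ x) (sumℤ-cong λ k → zeros _ (Fin.punchInᵢ≢i i k)) ⟩
  t i ℤ.+ sumℤ {r} (λ _ → ℤ.0ℤ)                   ≡⟨ ≡.cong (λ x → t i ℤ.+ x) (sumℤ-zero r) ⟩
  t i ℤ.+ ℤ.0ℤ                                    ≡⟨ ℤ.+-identityʳ (t i) ⟩
  t i                                             ∎
  where open ≡.≡-Reasoning

module _ {r} (S T U : Matrix r) (ds es fs : Vec ℕ r)
         (S≋ : S ≋ diag ds) (T≋ : T ≋ diag es) (U≋ : U ≋ diag fs) where
  open ≡.≡-Reasoning

  *ᴹ-diag : ∀ i j → (T *ᴹ U) i j ≡ + lookup es i ℤ.* diag fs i j
  *ᴹ-diag i j = ≡.trans (sum-single _ i λ k k≢i → begin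
      T i k ℤ.* U k j  ≡⟨ ≡.cong (ℤ._* U k j) (≡.trans (T≋ i k) (diag-≢ es (k≢i ∘ ≡.sym))) ⟩
      ℤ.0ℤ ℤ.* U k j   ≡⟨ ℤ.*-zeroˡ (U k j) ⟩
      ℤ.0ℤ             ∎)
    (≡.cong₂ ℤ._*_ (≡.trans (T≋ i i) (diag-≡ es i)) (U≋ i j))

  diag-factors : S ≋ T *ᴹ U ⇔ (∀ i → lookup ds i ≡ lookup es i * lookup fs i)
  diag-factors = mk⇔
    (λ S≋TU i → ℤ.+-injective (begin
      + lookup ds i                       ≡⟨ diag-≡ ds i ⟨
      diag ds i i                         ≡⟨ S≋ i i ⟨
      S i i                               ≡⟨ S≋TU i i ⟩
      (T *ᴹ U) i i                        ≡⟨ *ᴹ-diag i i ⟩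
      + lookup es i ℤ.* diag fs i i       ≡⟨ ≡.cong (+ lookup es i ℤ.*_) (diag-≡ fs i) ⟩
      + lookup es i ℤ.* + lookup fs i     ≡⟨ ℤ.pos-* (lookup es i) (lookup fs i) ⟨
      + (lookup es i * lookup fs i)       ∎))
    (λ eq i j → ≡.trans (S≋ i j) (≡.trans (entry eq i j) (≡.sym (*ᴹ-diag i j))))
    where
    entry : (∀ i → lookup ds i ≡ lookup es i * lookup fs i) →
            ∀ i j → diag ds i j ≡ + lookup es i ℤ.* diag fs i j
    entry eq i j with i Fin.≟ j
    ... | yes _ = ≡.trans (≡.cong +_ (eq i)) (ℤ.pos-* (lookup es i) (lookup fs i))
    ... | no  _ = ≡.sym (ℤ.*-zeroʳ (+ lookup es i))

-- Equal counts make es the conjugate of xs up to zeros, and two transpositions cancel: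
-- `count-sorted` turns an entry of es into a count of es, `count-conjugate` turns that into a count
-- of xs. The second half holds because the conjugate has at most r positive parts, so no part of xs
-- exceeds r.
sorted-exponents : ∀ {r} (es : Vec ℕ r) xs →
  (∀ i j → i Fin.≤ j → lookup es i ≤ lookup es j) →
  (∀ k → count k (toList es) ≡ count k (conjugate xs)) →
  (∀ i → lookup es i ≡ count (toℕ (opposite i)) xs) × (∀ j → r ≤ j → count j xs ≡ 0)
sorted-exponents {r} es xs sorted eq =
  (λ i → <-ext λ k → count-conjugate xs (toℕ (opposite i)) k ⇔-∘
    (≡.subst (λ c → (k < lookup es i) ⇔ (toℕ (opposite i) < c)) (eq k) (count-sorted es sorted i k))) ,
  (λ j r≤j → ℕ.n≤0⇒n≡0 (ℕ.≮⇒≥ λ 0<c → ℕ.<⇒≱ (Equivalence.from (count-conjugate xs j 0) 0<c)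
    (ℕ.≤-trans (≡.subst (_≤ r) (eq 0)
      (≡.subst (count 0 (toList es) ≤_) (length-toList es) (count≤length 0 (toList es)))) r≤j)))

-- The diagonal of M(G′) in terms of the type of G

module Invariants (G : FiniteAbelianGroup a ℓ₁) (G′ : AbelianGroup b ℓ₂) (conj : IsConjugate G G′)
                  {r} (S : Matrix r) (isM : IsM G′ S) where
  open FiniteAbelianGroup G using (abelianGroup; order)

  type : ℕ → List ℕ
  type = typeAt G (proj₁ conj)

  components : List ℕ → AbelianGroup 0ℓ 0ℓ
  components ps = ⨁ (map (λ p → pGroup p (type p)) ps)

  decompose : ∀ n → .{{NonZero n}} → order ∣ℕ n → Iso (components (primeDivisors n)) abelianGroup
  decompose = decomposition G (proj₁ conj) (proj₁ (proj₂ conj))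

  ds : Vec ℕ r
  ds = partialProducts (proj₁ isM)

  ds≢0 : VecAll.All NonZero ds
  ds≢0 = partialProducts-nonZero (proj₁ (proj₂ isM))

  lookup≢0 : ∀ i → NonZero (lookup ds i)
  lookup≢0 i = VecAll.lookup ds≢0 (∈-lookup i ds)

  S≋diag : S ≋ diag ds
  S≋diag = proj₂ (proj₂ (proj₂ isM))

  isSNF : IsSNF S
  isSNF = proj₁ isM , proj₁ (proj₂ isM) , S≋diag

  module _ {p} (p-prime : Prime p) where

    torsion : ∀ k → TorsionCount abelianGroup (p ^ k) (p ^ weight k (type p))
    torsion k = torsionCount-iso (decompose order {{order-nonZero G}} ℕ∣.∣-refl)
      (torsionCount-⨁ p-prime type k (primeDivisors-prime order) (primeDivisors-unique order)
        (typeAt-∉ G (proj₁ conj)))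

    private
      conjugate-iso : Iso (⨁ (map (λ q → pGroup q (conjugate (type q))) (primeDivisors order))) G′
      conjugate-iso = Iso-trans
        (⨁-map-cong (primeDivisors order) λ {q} q∈ →
          ≡.subst (λ xs → Iso (pGroup q (conjugate (type q))) (pGroup q (conjugate xs)))
            (typeAt-∈ G (proj₁ conj) q∈) Iso-refl)
        (Iso-sym (≅⇒Iso G′ (⨁ (map (λ q → pGroup q (conjugate (proj₁ conj q))) (primeDivisors order)))
          (proj₂ (proj₂ conj))))

      es : Vec ℕ r
      es = Vec.map (valuation p) ds

      es-has : ∀ i → HasValuation p (lookup ds i) (valuation p (lookup ds i))
      es-has i = valuation-has p (lookup ds i) {{prime⇒nonTrivial p-prime}} {{lookup≢0 i}}

      -- Both sides are exponents of one number, that of the elements of G′ killed by p ^ k,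
      -- computed from the invariant factors and from the conjugate types.
      weights : ∀ k → weight k (toList es) ≡ weight k (conjugate (type p))
      weights k = ^-injectiveʳ (ℕ.nonTrivial⇒n>1 p {{prime⇒nonTrivial p-prime}}) (torsionCount-unique
        (torsionCount-iso (Iso-sym (≅⇒Iso G′ (⨁ (map ℤ/_ (toList ds))) (proj₁ (proj₂ (proj₂ isM)))))
          (torsionCount-invariantFactors p-prime k ds≢0))
        (torsionCount-iso conjugate-iso (torsionCount-⨁ p-prime (conjugate ∘ type) k
          (primeDivisors-prime order) (primeDivisors-unique order)
          (≡.cong conjugate ∘ typeAt-∉ G (proj₁ conj)))))

      sorted : ∀ i j → i Fin.≤ j → lookup es i ≤ lookup es j
      sorted i j i≤j rewrite lookup-map i (valuation p) ds | lookup-map j (valuation p) ds =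
        valuation-mono p-prime {e = valuation p (lookup ds i)} {valuation p (lookup ds j)}
          (es-has i) (es-has j) (partialProducts-∣ (proj₁ isM) i j i≤j)

      exponents = sorted-exponents es (type p) sorted
        (weight≗⇒count≗ (toList es) (conjugate (type p)) weights)

    ds-valuation : ∀ i → HasValuation p (lookup ds i) (count (toℕ (opposite i)) (type p))
    ds-valuation i = ≡.subst (HasValuation p (lookup ds i))
      (≡.trans (≡.sym (lookup-map i (valuation p) ds)) (proj₁ exponents i)) (es-has i)

    count-vanishes : ∀ j → r ≤ j → count j (type p) ≡ 0
    count-vanishes = proj₂ exponents

-- Additivity of the counts, linked to both sides of the equivalence

module Factorisation {c ℓ c′ ℓ′ : Level} (G H K : FiniteAbelianGroup c ℓ) (G′ H′ K′ : AbelianGroup c′ ℓ′)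
         (conjG : IsConjugate G G′) (conjH : IsConjugate H H′) (conjK : IsConjugate K K′)
         (r : ℕ) (S T U : Matrix r) (S-isM : IsM G′ S) (T-isM : IsM H′ T) (U-isM : IsM K′ U) where
  private
    module G = Invariants G G′ conjG S S-isM
    module H = Invariants H H′ conjH T T-isM
    module K = Invariants K K′ conjK U U-isM
    module ⟨G⟩ = FiniteAbelianGroup G
    module ⟨H⟩ = FiniteAbelianGroup H
    module ⟨K⟩ = FiniteAbelianGroup K

    factors : S ≋ T *ᴹ U ⇔ (∀ i → lookup G.ds i ≡ lookup H.ds i * lookup K.ds i)
    factors = diag-factors S T U G.ds H.ds K.ds G.S≋diag H.S≋diag K.S≋diag

  -- Stated with the concatenated type so that it fits `pGroup-iso` and `weight≗⇒count≗` directly.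
  -- All primes are included, since comparing the diagonal entries requires their valuations
  -- everywhere.
  CountsAdd : Set
  CountsAdd = ∀ {p} → Prime p → ∀ j → count j (G.type p) ≡ count j (H.type p ++ K.type p)

  factorisation⇒countsAdd : S ≋ T *ᴹ U → CountsAdd
  factorisation⇒countsAdd S≋TU {p} p-prime j =
    ≡.trans (additive (j ℕ.<? r)) (≡.sym (count-++ j (H.type p) (K.type p)))
    where
    additive-opposite : ∀ i → count (toℕ (opposite i)) (G.type p) ≡
                              count (toℕ (opposite i)) (H.type p) + count (toℕ (opposite i)) (K.type p)
    additive-opposite i = valuation-unique p-prime (G.ds-valuation p-prime i)
      (≡.subst (λ n → HasValuation p n (eH + eK)) (≡.sym (Equivalence.to factors S≋TU i))
        (valuation-* p-prime {e = eH} {eK} (H.ds-valuation p-prime i) (K.ds-valuation p-prime i)))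
      where
      eH = count (toℕ (opposite i)) (H.type p)
      eK = count (toℕ (opposite i)) (K.type p)

    additive : Dec (j < r) → count j (G.type p) ≡ count j (H.type p) + count j (K.type p)
    -- The j-th count is the valuation of the diagonal entry at distance j from the end.
    additive (yes j<r) = ≡.subst (λ j → count j (G.type p) ≡ count j (H.type p) + count j (K.type p))
      (≡.trans (≡.cong toℕ (Fin.opposite-involutive (fromℕ< j<r))) (Fin.toℕ-fromℕ< j<r))
      (additive-opposite (opposite (fromℕ< j<r)))
    -- Beyond the size of the matrices there is no entry to compare, but all three counts are zero.
    additive (no j≮r) = ≡.trans (G.count-vanishes p-prime j (ℕ.≮⇒≥ j≮r))
      (≡.sym (≡.cong₂ _+_ (H.count-vanishes p-prime j (ℕ.≮⇒≥ j≮r))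
                           (K.count-vanishes p-prime j (ℕ.≮⇒≥ j≮r))))

  countsAdd⇒iso : CountsAdd → Iso ⟨G⟩.abelianGroup (⟨H⟩.abelianGroup ⊕ ⟨K⟩.abelianGroup)
  countsAdd⇒iso add =
    Iso-trans (Iso-sym (G.decompose N (ℕ∣.∣m⇒∣m*n ⟨K⟩.order (ℕ∣.m∣m*n ⟨H⟩.order)))) (
    Iso-trans (⨁-map-cong ps λ {p} p∈ → Iso-trans
      (pGroup-iso p (G.type p) (H.type p ++ K.type p) (add (All.lookup (primeDivisors-prime N) p∈)))
      (pGroup-++ p (H.type p) (K.type p))) (
    Iso-trans (⨁-map-⊕ (λ p → pGroup p (H.type p)) (λ p → pGroup p (K.type p)) ps) (
    ⊕-cong (H.components ps) ⟨H⟩.abelianGroup (K.components ps) ⟨K⟩.abelianGroup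
      (H.decompose N (ℕ∣.∣m⇒∣m*n ⟨K⟩.order (ℕ∣.n∣m*n ⟨G⟩.order)))
      (K.decompose N (ℕ∣.n∣m*n (⟨G⟩.order * ⟨H⟩.order))))))
    where
    -- A common multiple of the three orders, so that the decompositions run over one list of primes
    -- and can be matched summand by summand.
    N  = ⟨G⟩.order * ⟨H⟩.order * ⟨K⟩.order
    ps = primeDivisors N
    instance
      G≢0 : NonZero ⟨G⟩.order
      G≢0 = order-nonZero G
      H≢0 : NonZero ⟨H⟩.order
      H≢0 = order-nonZero H
      K≢0 : NonZero ⟨K⟩.order
      K≢0 = order-nonZero K
      N≢0 : NonZero N
      N≢0 = ℕ.m*n≢0 (⟨G⟩.order * ⟨H⟩.order) ⟨K⟩.order {{ℕ.m*n≢0 ⟨G⟩.order ⟨H⟩.order}}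

  iso⇒countsAdd : Iso ⟨G⟩.abelianGroup (⟨H⟩.abelianGroup ⊕ ⟨K⟩.abelianGroup) → CountsAdd
  iso⇒countsAdd φ {p} p-prime = weight≗⇒count≗ (G.type p) (H.type p ++ K.type p) λ k →
    ^-injectiveʳ (ℕ.nonTrivial⇒n>1 p {{prime⇒nonTrivial p-prime}}) (begin
      p ^ weight k (G.type p)
        ≡⟨ torsionCount-unique (torsionCount-iso φ (G.torsion p-prime k))
             (torsionCount-⊕ ⟨H⟩.abelianGroup ⟨K⟩.abelianGroup (H.torsion p-prime k) (K.torsion p-prime k)) ⟩
      p ^ weight k (H.type p) * p ^ weight k (K.type p)
        ≡⟨ ℕ.^-distribˡ-+-* p (weight k (H.type p)) (weight k (K.type p)) ⟨
      p ^ (weight k (H.type p) + weight k (K.type p))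
        ≡⟨ ≡.cong (p ^_) (weight-++ k (H.type p) (K.type p)) ⟨
      p ^ weight k (H.type p ++ K.type p) ∎)
    where open ≡.≡-Reasoning

  countsAdd⇒factorisation : CountsAdd → S ≋ T *ᴹ U
  countsAdd⇒factorisation add = Equivalence.from factors λ i →
    ≡-by-valuations {{G.lookup≢0 i}}
      {{ℕ.m*n≢0 (lookup H.ds i) (lookup K.ds i) {{H.lookup≢0 i}} {{K.lookup≢0 i}}}}
      λ {p} p-prime →
        let j = toℕ (opposite i) in
        count j (G.type p) , G.ds-valuation p-prime i ,
        ≡.subst (HasValuation p (lookup H.ds i * lookup K.ds i))
          (≡.sym (≡.trans (add p-prime j) (count-++ j (H.type p) (K.type p))))
          (valuation-* p-prime {e = count j (H.type p)} {count j (K.type p)}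
            (H.ds-valuation p-prime i) (K.ds-valuation p-prime i))

open FiniteAbelianGroup using (abelianGroup)

proposition1 : ∀ {c ℓ c′ ℓ′ : Level}
    (G H K : FiniteAbelianGroup c ℓ)
    (G′ H′ K′ : AbelianGroup c′ ℓ′) →
    IsConjugate G G′ → IsConjugate H H′ → IsConjugate K K′ →
    ∀ (r : ℕ) (M[G′] M[H′] M[K′] : Matrix r) →
    IsM G′ M[G′] → IsM H′ M[H′] → IsM K′ M[K′] →
    (IsSNFFactorisation M[G′] M[H′] M[K′] →
    abelianGroup G ≅ (abelianGroup H ⊕ abelianGroup K)) ×
    (abelianGroup G ≅ (abelianGroup H ⊕ abelianGroup K) →
    IsSNFFactorisation M[G′] M[H′] M[K′])
proposition1 G H K G′ H′ K′ conjG conjH conjK r S T U S-isM T-isM U-isM =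
  (λ (_ , _ , _ , S≋TU) → Iso⇒≅ (P.countsAdd⇒iso (P.factorisation⇒countsAdd S≋TU))) ,
  -- Being in Smith normal form is part of `IsM` for each matrix; the product formula is what
  -- remains.
  (λ G≅H⊕K → Invariants.isSNF G G′ conjG S S-isM ,
             Invariants.isSNF H H′ conjH T T-isM ,
             Invariants.isSNF K K′ conjK U U-isM ,
             P.countsAdd⇒factorisation
               (P.iso⇒countsAdd (≅⇒Iso (abelianGroup G) (abelianGroup H ⊕ abelianGroup K) G≅H⊕K)))
  where module P = Factorisation G H K G′ H′ K′ conjG conjH conjK r S T U S-isM T-isM U-isM
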